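{- Let $n\ge1$, let $p\in\mathbb Z^n$ be a primitive vector, $\Psi(z)=\min(0,p\cdot z)$ for $z\in\mathbb Z^n$, let $\psi$ be the canonical husking of $\Psi$, let $q\in\mathbb Z^n$ satisfy $p\cdot q=1$, and let $\phi=2n-1+\Delta\psi$ (a stable sandpile state). Then for every $z_0\in\mathbb Z^n$ far from $D(\psi)$ (i.e. there is $R>0$ such that for every $z_0\in\mathbb Z^n$ at Euclidean distance greater than $R$ from $D(\psi)$) and all $z\in\mathbb Z^n$, $$(W^{z_0}\phi)(z)=2n-1+\Delta\psi(z\pm q)=\phi(z\pm q),$$ where the sign is "$+$" if $\psi(z_0)<0$ and "$-$" if $\psi(z_0)=0$.
   Context: A vector $p\in\mathbb Z^n\setminus\{0\}$ is primitive if there are no integer $k>1$ and $p'\in\mathbb Z^n$ with $p=kp'$. For $z,z'\in\mathbb Z^n$, $z\sim z'$ means that their Euclidean distance is $1$. The discrete Laplacian is $\Delta F(z)=-2nF(z)+\sum_{z'\sim z}F(z')$; $F$ is superharmonic if $\Delta F\le0$ everywhere. $D(F)=\{z:\Delta F(z)\neq0\}$. $B_C(S)$ is the set of points of $\mathbb Z^n$ at Euclidean distance at most $C$ from $S$. For a superharmonic $F:\mathbb Z^n\to\mathbb Z$ and $k\in\mathbb Z_{\ge0}$, $$\Theta_k(F)=\{G:\mathbb Z^n\to\mathbb Z\mid\Delta G\le0,\ F-k\le G\le F,\ \exists C>0:\{F\ne G\}\subset B_C(D(F))\},$$ and $(F)_k(z)=\min\{G(z):G\in\Theta_k(F)\}$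 is the $k$-husking of $F$. For $\Psi=\min(0,p\cdot z)$ with $p$ primitive the sequence $(\Psi)_k$ is eventually constant in $k$ and its eventual value is the pointwise minimal function in $\bigcup_k\Theta_k(\Psi)$; it is called the canonical husking of $\Psi$ and denoted $\psi$. It satisfies $-2n+1\le\Delta\psi\le0$. A sandpile state is a function $\phi:\mathbb Z^n\to\mathbb Z_{\ge0}$; it is stable if $\phi\le 2n-1$. A toppling at $z$ subtracts $2n$ grains from $z$ and adds one grain to each neighbour of $z$; it is legal if there are at least $2n$ grains at $z$. Relaxation means doing legal topplings while it is possible (possibly infinitely many in total); the result does not depend on the order. If $\phi(z)=\phi(z')=2n-1$ for some $z'\sim z$, sending a wave from $z$ means making one toppling at $z$ followed by the relaxation; the resulting state is denoted $W^z\phi$ (starting from a stable state each vertex topples at most once during a wave). -}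

module Defs where

import Data.Nat as ℕ
open ℕ using (ℕ; zero; suc)
import Data.Nat.Properties as ℕₚ
import Data.Integer as ℤ
open ℤ
  using (ℤ; +_; -[1+_]; 0ℤ; 1ℤ; -1ℤ; ∣_∣; _+_; _-_; -_; _*_; _⊓_; _≤_; _<_)
import Data.Integer.Properties as ℤₚ
import Algebra.Properties.AbelianGroup ℤₚ.+-0-abelianGroup as ℤ+
import Data.Vec.Base as Vec
open Vec using (Vec; []; _∷_; zipWith; foldr′; replicate)
import Data.Vec.Properties as Vecₚ
import Data.List.Base as List
open List using (List; []; _∷_)
open import Data.List.Membership.Propositional using (_∈_)
open import Data.List.Membership.Propositional.Properties using (∈-map⁺; ∈-map⁻)
open import Data.List.Relation.Unary.Any using (here; there)
import Data.List.Relation.Unary.All as All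
open All using (All; []; _∷_)
open import Data.List.Relation.Unary.AllPairs using ([]; _∷_)
open import Data.List.Relation.Unary.Unique.Propositional using (Unique)
import Data.List.Relation.Unary.Unique.Propositional.Properties as Uniqueₚ
open import Data.Maybe.Base using (Maybe; just; nothing)
open import Data.Bool.Base using (if_then_else_)
open import Data.Product.Base using (∃-syntax; _×_; _,_)
open import Relation.Nullary using (¬_; Dec)
open import Relation.Nullary.Decidable using (⌊_⌋)
open import Relation.Unary using (Pred)
open import Relation.Binary.PropositionalEquality
  using (_≡_; _≢_; refl; sym; trans; cong; cong₂; subst)
open import Level using (0ℓ)

infixl 6 _⊕_ _⊖_
infixl 7 _∙_
infixr 7 _·_
infix  4 _~_ _≟_

ℤ^ : ℕ → Set
ℤ^ n = Vec ℤ n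

_≟_ : ∀ {n} (x y : ℤ^ n) → Dec (x ≡ y)
_≟_ = Vecₚ.≡-dec ℤ._≟_

_⊕_ _⊖_ : ∀ {n} → ℤ^ n → ℤ^ n → ℤ^ n
_⊕_ = zipWith _+_
_⊖_ = zipWith _-_

_·_ : ∀ {n} → ℤ → ℤ^ n → ℤ^ n
k · x = Vec.map (k *_) x

_∙_ : ∀ {n} → ℤ^ n → ℤ^ n → ℤ
x ∙ y = foldr′ _+_ 0ℤ (zipWith _*_ x y)

Primitive : ∀ {n} → ℤ^ n → Set
Primitive {n} p =
  p ≢ replicate n 0ℤ × ¬ (∃[ k ] ∃[ p′ ] (1ℤ < k × p ≡ k · p′))

-- The square of the Euclidean distance.  All distances below are compared
-- through their squares, which are natural numbers.
dist² : ∀ {n} → ℤ^ n → ℤ^ n → ℕ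
dist² x y = Vec.sum (zipWith (λ a b → ∣ a - b ∣ ℕ.^ 2) x y)

_~_ : ∀ {n} → ℤ^ n → ℤ^ n → Set
x ~ y = dist² x y ≡ 1

-- The points at distance 1, listed without repetition; see
-- ∈-neighbours⇒~, ~⇒∈-neighbours and neighbours-unique.
neighbours : ∀ {n} → ℤ^ n → List (ℤ^ n)
neighbours []       = []
neighbours (a ∷ x) =
  (a + 1ℤ ∷ x) ∷ (a - 1ℤ ∷ x) ∷ List.map (a ∷_) (neighbours x)

Δ : ∀ {n} → (ℤ^ n → ℤ) → ℤ^ n → ℤ
Δ {n} F z =
  - (+ (2 ℕ.* n)) * F z + List.foldr _+_ 0ℤ (List.map F (neighbours z))

Superharmonic : ∀ {n} → (ℤ^ n → ℤ) → Set
Superharmonic F = ∀ z → Δ F z ≤ 0ℤ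

D : ∀ {n} → (ℤ^ n → ℤ) → Pred (ℤ^ n) 0ℓ
D F z = Δ F z ≢ 0ℤ

-- Distances from S to lattice points are attained, so "at distance at most C
-- from S" means that some point of S is that close.
B : ∀ {n} → ℕ → Pred (ℤ^ n) 0ℓ → Pred (ℤ^ n) 0ℓ
B C S z = ∃[ s ] (S s × dist² z s ℕ.≤ C ℕ.^ 2)

-- z is at distance greater than R from S.
Far : ∀ {n} → ℕ → Pred (ℤ^ n) 0ℓ → Pred (ℤ^ n) 0ℓ
Far R S z = ∀ s → S s → R ℕ.^ 2 ℕ.< dist² z s

-- A natural number C loses nothing against a real C, the ball being
-- increasing in its radius.
record Θ {n} (k : ℕ) (F G : ℤ^ n → ℤ) : Set where
  field
    superharmonic : Superharmonic G
    lower         : ∀ z → F z - + k ≤ G z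
    upper         : ∀ z → G z ≤ F z
    near          : ∃[ C ] (0 ℕ.< C × (∀ z → F z ≢ G z → B C (D F) z))

-- H is (F)ₖ: at each point z, H z is the minimum of G z over G ∈ Θₖ(F).
-- The minimizer G may depend on z.
IsHusking : ∀ {n} → ℕ → (F H : ℤ^ n → ℤ) → Set
IsHusking k F H =
  ∀ z → (∃[ G ] (Θ k F G × G z ≡ H z)) × (∀ G → Θ k F G → H z ≤ G z)

Ψ : ∀ {n} → ℤ^ n → ℤ^ n → ℤ
Ψ p z = 0ℤ ⊓ (p ∙ z)

-- ψ is the eventual value of the sequence of k-huskings of Ψ p.
IsCanonicalHusking : ∀ {n} → ℤ^ n → (ℤ^ n → ℤ) → Set
IsCanonicalHusking p ψ = ∃[ K ] (∀ k → K ℕ.≤ k → IsHusking k (Ψ p) ψ)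

-- States are integer-valued because the first toppling of a wave leaves -1
-- grains at its vertex.
State : ℕ → Set
State n = ℤ^ n → ℤ

-- The number 2n - 1 of grains at a maximally filled stable vertex.
full : ℕ → ℤ
full n = + (2 ℕ.* n) - 1ℤ

topple : ∀ {n} → ℤ^ n → State n → State n
topple {n} z σ x =
  if ⌊ x ≟ z ⌋ then σ x - + (2 ℕ.* n)
  else if ⌊ dist² x z ℕ.≟ 1 ⌋ then σ x + 1ℤ
  else σ x

Unstable : ∀ {n} → State n → Pred (ℤ^ n) 0ℓ
Unstable {n} σ z = + (2 ℕ.* n) ≤ σ z

-- At each time at most one vertex is toppled; idle times allow a process that
-- needs only finitely many topplings.
Schedule : ℕ → Set
Schedule n = ℕ → Maybe (ℤ^ n)

step : ∀ {n} → Maybe (ℤ^ n) → State n → State n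
step nothing  σ = σ
step (just z) σ = topple z σ

run : ∀ {n} → Schedule n → State n → ℕ → State n
run s σ zero    = σ
run s σ (suc t) = step (s t) (run s σ t)

-- Legal topplings are performed as long as any is possible: no vertex that
-- can be toppled is neglected forever.
record Relaxation {n} (σ : State n) : Set where
  field
    schedule   : Schedule n
    legal      : ∀ t z → schedule t ≡ just z → Unstable (run schedule σ t) z
    exhaustive : ∀ t z → Unstable (run schedule σ t) z →
                 ∃[ t′ ] (t ℕ.≤ t′ × schedule t′ ≡ just z)

-- In the limit the state is χ: at each vertex the number of grains is
-- eventually that of χ.
_EndsAt_ : ∀ {n} {σ : State n} → Relaxation σ → State n → Set
_EndsAt_ {σ = σ} r χ =
  ∀ z → ∃[ T ] (∀ t → T ℕ.≤ t → run (Relaxation.schedule r) σ t z ≡ χ z)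

-- χ is the result of relaxing σ, whatever the order of topplings.
IsRelaxed : ∀ {n} → (σ χ : State n) → Set
IsRelaxed σ χ = Relaxation σ × (∀ (r : Relaxation σ) → r EndsAt χ)

-- A wave can be sent from z in φ, and the resulting state Wᶻφ is χ.
record IsWave {n} (z : ℤ^ n) (φ χ : State n) : Set where
  field
    full-at  : φ z ≡ full n
    full-by  : ∃[ z′ ] (z′ ~ z × φ z′ ≡ full n)
    relaxed  : IsRelaxed (topple z φ) χ

------------------------------------------------------------------------
-- neighbours z enumerates { z′ : z ~ z′ }

private
  a-[a+b] : ∀ a b → a - (a + b) ≡ - b
  a-[a+b] a b = trans (cong (λ c → a + c) (ℤₚ.neg-distrib-+ a b))
    (trans (sym (ℤₚ.+-assoc a (- a) (- b)))
    (trans (cong (_+ (- b)) (ℤₚ.+-inverseʳ a)) (ℤₚ.+-identityˡ (- b))))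

  a-[a-b] : ∀ a b → a - (a - b) ≡ b
  a-[a-b] a b = trans (a-[a+b] a (- b)) (ℤₚ.neg-involutive b)

  solve-diff : ∀ a b c → a - b ≡ c → b ≡ a - c
  solve-diff a b c eq =
    trans (sym (a-[a-b] a b)) (cong (λ x → a - x) eq)

  a-a : ∀ a → ∣ a - a ∣ ℕ.^ 2 ≡ 0
  a-a a = cong (λ c → ∣ c ∣ ℕ.^ 2) (ℤₚ.+-inverseʳ a)

  dist²-refl : ∀ {n} (x : ℤ^ n) → dist² x x ≡ 0
  dist²-refl []      = refl
  dist²-refl (a ∷ x) = cong₂ ℕ._+_ (a-a a) (dist²-refl x)

  dist²≡0⇒≡ : ∀ {n} (x y : ℤ^ n) → dist² x y ≡ 0 → x ≡ y
  dist²≡0⇒≡ []      []      _  = refl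
  dist²≡0⇒≡ (a ∷ x) (b ∷ y) eq = cong₂ _∷_
    (ℤₚ.i-j≡0⇒i≡j a b (ℤₚ.∣i∣≡0⇒i≡0
      (ℕₚ.m^n≡0⇒m≡0 ∣ a - b ∣ 2 (ℕₚ.m+n≡0⇒m≡0 _ eq))))
    (dist²≡0⇒≡ x y (ℕₚ.m+n≡0⇒n≡0 (∣ a - b ∣ ℕ.^ 2) eq))

  a≢a+b : ∀ a b → b ≢ 0ℤ → a ≢ a + b
  a≢a+b a b b≢0 eq = b≢0 (sym (ℤ+.∙-cancelˡ a 0ℤ b (trans (ℤₚ.+-identityʳ a) eq)))

∈-neighbours⇒~ : ∀ {n} (x y : ℤ^ n) → y ∈ neighbours x → x ~ y
∈-neighbours⇒~ (a ∷ x) _ (here refl) = cong₂ ℕ._+_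
  (cong (λ c → ∣ c ∣ ℕ.^ 2) (a-[a+b] a 1ℤ)) (dist²-refl x)
∈-neighbours⇒~ (a ∷ x) _ (there (here refl)) = cong₂ ℕ._+_
  (cong (λ c → ∣ c ∣ ℕ.^ 2) (a-[a-b] a 1ℤ)) (dist²-refl x)
∈-neighbours⇒~ (a ∷ x) _ (there (there y∈)) with ∈-map⁻ (a ∷_) y∈
... | y , y∈′ , refl = cong₂ ℕ._+_ (a-a a) (∈-neighbours⇒~ x y y∈′)

~⇒∈-neighbours : ∀ {n} (x y : ℤ^ n) → x ~ y → y ∈ neighbours x
~⇒∈-neighbours []      []      ()
~⇒∈-neighbours (a ∷ x) (b ∷ y) eq with a - b in d
... | + 0 = subst (λ c → (c ∷ y) ∈ neighbours (a ∷ x)) (ℤₚ.i-j≡0⇒i≡j a b d)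
              (there (there (∈-map⁺ (a ∷_) (~⇒∈-neighbours x y eq))))
... | + 1 = there (here (cong₂ _∷_ (solve-diff a b 1ℤ d)
              (sym (dist²≡0⇒≡ x y (ℕₚ.suc-injective eq)))))
... | -[1+ 0 ] = here (cong₂ _∷_ (solve-diff a b -1ℤ d)
                   (sym (dist²≡0⇒≡ x y (ℕₚ.suc-injective eq))))
~⇒∈-neighbours (a ∷ x) (b ∷ y) () | + suc (suc m)
~⇒∈-neighbours (a ∷ x) (b ∷ y) () | -[1+ suc m ]

neighbours-unique : ∀ {n} (x : ℤ^ n) → Unique (neighbours x)
neighbours-unique []      = []
neighbours-unique (a ∷ x) =
  (ne ∷ off 1ℤ (λ ())) ∷ off -1ℤ (λ ()) ∷
  Uniqueₚ.map⁺ Vecₚ.∷-injectiveʳ (neighbours-unique x)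
  where
  ne : (a + 1ℤ ∷ x) ≢ (a - 1ℤ ∷ x)
  ne eq with ℤ+.∙-cancelˡ a 1ℤ -1ℤ (Vecₚ.∷-injectiveˡ eq)
  ... | ()
  off : ∀ b → b ≢ 0ℤ →
        All ((a + b ∷ x) ≢_) (List.map (a ∷_) (neighbours x))
  off b b≢0 = All.tabulate λ y∈ eq → case-map b b≢0 (∈-map⁻ (a ∷_) y∈) eq
    where
    case-map : ∀ b → b ≢ 0ℤ → ∀ {y} →
               (∃[ v ] (v ∈ neighbours x × y ≡ a ∷ v)) → (a + b ∷ x) ≢ y
    case-map b b≢0 (v , _ , refl) eq =
      a≢a+b a b b≢0 (sym (Vecₚ.∷-injectiveˡ eq))

{-# OPTIONS --safe #-}

-- By minimality ψ depends on p ∙ z only, agrees with Ψ far from the hyperplane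
-- p ∙ z = 0, and u z = ψ (z ⊕ q) - ψ z takes the values 0 and 1.  Since
-- φ + Δ u = φ (· ⊕ q) is stable, the least action principle bounds the odometer of a
-- wave by u.  Conversely, the wave spreads over the half-space below; afterwards only
-- finitely many levels of p ∙ z are left, and as long as one of them has not
-- toppled, some whole level is unstable, for otherwise lowering ψ on the remaining
-- levels would give a superharmonic function, against minimality.  Hence every
-- vertex with u z = 1 topples after finitely many predecessors do.

module Submission where

open import Defs
import Data.Nat.Base as ℕ
open import Data.Nat.Base using (ℕ; zero; suc)
import Data.Nat.Properties as ℕₚ
open import Data.Integer.Base
  using (ℤ; +_; -[1+_]; 0ℤ; 1ℤ; -1ℤ; ∣_∣; _+_; _-_; -_; _*_; _⊓_; _≤_; _<_; +≤+; -≤+)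
import Data.Integer.Properties as ℤₚ
open import Data.Integer.Tactic.RingSolver using (solve-∀)
open import Data.Nat.Tactic.RingSolver using () renaming (solve-∀ to ℕ-solve-∀)
open import Data.Nat.ListAction using (sum)
open import Data.Vec.Base as Vec using ([]; _∷_; replicate)
open import Data.List.Base as List using (List; []; _∷_)
import Data.List.Properties as Listₚ
open import Data.List.Membership.Propositional using (_∈_; _∉_; lose; find)
open import Data.List.Membership.Propositional.Properties
  using (∈-map⁺; ∈-++⁺ˡ; ∈-++⁺ʳ; ∈-upTo⁺; ∈-filter⁺; ∈-length)
open import Data.List.Membership.DecPropositional ℤₚ._≟_ using (_∈?_)
open import Data.List.Relation.Unary.Any using (here; there; any?)
import Data.List.Relation.Unary.All as All
open import Data.List.Relation.Unary.AllPairs using (_∷_)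
open import Data.List.Relation.Unary.Unique.Propositional using (Unique)
open import Data.Maybe.Base using (Maybe; just; nothing)
import Data.Maybe.Properties as Maybeₚ
open import Data.Bool.Base using (if_then_else_)
open import Data.Product.Base using (∃-syntax; _×_; _,_; proj₁; proj₂)
open import Data.Sum.Base as Sum using (_⊎_; inj₁; inj₂)
open import Function.Base using (_∘_; case_of_)
open import Relation.Nullary using (¬_; Dec; yes; no; contradiction)
open import Relation.Nullary.Decidable using (⌊_⌋; ¬?; decidable-stable)
open import Relation.Binary.PropositionalEquality
  using (_≡_; _≢_; refl; sym; trans; cong; cong₂; subst; subst₂; module ≡-Reasoning)

-- Two obstacles shape the proof. First, the radius in `near` depends on the competitor, and the
-- minimizer depends on the point, so the definition of a husking bounds no common strip outside
-- which `ψ` and `Ψ` agree. The missing uniformity comes from `Ψ - K ≤ ψ`: a negative value of `ψ`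
-- forces a strictly smaller one at most `∥ p ∥` levels lower, and such a chain of decreasing values
-- has at most `K` steps above level 0. The side where `Ψ` is linear follows by passing from `p` to
-- `- p` and adding a harmonic function. Once the strip is known, minimality is used only through
-- comparison with suitable competitors: translates of `ψ`, and `ψ` modified on finitely many
-- levels. Second, a level is in general infinite and the order of topplings is arbitrary, so there
-- need be no moment at which a whole level has toppled. Propagation is therefore stated without
-- time: a set that contains the origin of the wave and is closed under toppling contains every
-- vertex with odometer 1. Time enters only when this is applied to the vertices that eventually
-- topple; there a common time is needed for the finitely many neighbours of one vertex only.

-- Linear inequalities are derived by exhibiting the slack of the conclusion
-- as a sum of slacks of the hypotheses.
≤-by₁ : ∀ {i j a b} → a ≤ b → j - i ≡ b - a → i ≤ j
≤-by₁ a≤b eq = ℤₚ.0≤i-j⇒j≤i (subst (0ℤ ≤_) (sym eq) (ℤₚ.i≤j⇒0≤j-i a≤b))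

≤-by₂ : ∀ {i j a b c d} → a ≤ b → c ≤ d → j - i ≡ (b - a) + (d - c) → i ≤ j
≤-by₂ a≤b c≤d eq = ℤₚ.0≤i-j⇒j≤i (subst (0ℤ ≤_) (sym eq)
  (ℤₚ.+-mono-≤ (ℤₚ.i≤j⇒0≤j-i a≤b) (ℤₚ.i≤j⇒0≤j-i c≤d)))

≤-by₃ : ∀ {i j a b c d e f} → a ≤ b → c ≤ d → e ≤ f →
        j - i ≡ (b - a) + (d - c) + (f - e) → i ≤ j
≤-by₃ a≤b c≤d e≤f eq = ℤₚ.0≤i-j⇒j≤i (subst (0ℤ ≤_) (sym eq)
  (ℤₚ.+-mono-≤ (ℤₚ.+-mono-≤ (ℤₚ.i≤j⇒0≤j-i a≤b) (ℤₚ.i≤j⇒0≤j-i c≤d))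
               (ℤₚ.i≤j⇒0≤j-i e≤f)))

1≰0 : ¬ (1ℤ ≤ 0ℤ)
1≰0 (+≤+ ())

≰⇒1+≤ : ∀ {i j} → ¬ (i ≤ j) → 1ℤ + j ≤ i
≰⇒1+≤ i≰j = ℤₚ.i<j⇒suc[i]≤j (ℤₚ.≰⇒> i≰j)

i≤+∣i∣ : ∀ i → i ≤ + ∣ i ∣
i≤+∣i∣ (+ _)    = ℤₚ.≤-refl
i≤+∣i∣ -[1+ _ ] = -≤+

-∣i∣≤i : ∀ i → - + ∣ i ∣ ≤ i
-∣i∣≤i i = ≤-by₁ (subst (λ m → - i ≤ + m) (ℤₚ.∣-i∣≡∣i∣ i) (i≤+∣i∣ (- i)))
  (slack i (+ ∣ i ∣))
  where
  slack : ∀ i m → i - - m ≡ m - - i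
  slack = solve-∀

≤∣i∣-cases : ∀ {m} i → m ℕ.≤ ∣ i ∣ → + m ≤ i ⊎ + m ≤ - i
≤∣i∣-cases (+ _)    m≤ = inj₁ (+≤+ m≤)
≤∣i∣-cases -[1+ _ ] m≤ = inj₂ (+≤+ m≤)

-- Finite sums and indicators

∑ : ∀ {A : Set} → (A → ℤ) → List A → ℤ
∑ F xs = List.foldr _+_ 0ℤ (List.map F xs)

module _ {A : Set} where

  ∑-mono-≤ : ∀ {F G : A → ℤ} xs → (∀ x → x ∈ xs → F x ≤ G x) → ∑ F xs ≤ ∑ G xs
  ∑-mono-≤ []       F≤G = ℤₚ.≤-refl
  ∑-mono-≤ (x ∷ xs) F≤G =
    ℤₚ.+-mono-≤ (F≤G x (here refl)) (∑-mono-≤ xs λ y y∈ → F≤G y (there y∈))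

  ∑-tight : ∀ {F G : A → ℤ} xs → (∀ x → x ∈ xs → F x ≤ G x) → ∑ G xs ≤ ∑ F xs →
            ∀ x → x ∈ xs → F x ≡ G x
  ∑-tight {F} {G} (x ∷ xs) F≤G ∑G≤∑F .x (here refl) =
    ℤₚ.≤-antisym (F≤G x (here refl))
      (≤-by₂ ∑G≤∑F (∑-mono-≤ xs λ y y∈ → F≤G y (there y∈))
        (slack (F x) (G x) (∑ F xs) (∑ G xs)))
    where
    slack : ∀ a b c d → a - b ≡ ((a + c) - (b + d)) + (d - c)
    slack = solve-∀
  ∑-tight {F} {G} (x ∷ xs) F≤G ∑G≤∑F y (there y∈) =
    ∑-tight xs (λ y y∈ → F≤G y (there y∈))
      (≤-by₂ ∑G≤∑F (F≤G x (here refl)) (slack (F x) (G x) (∑ F xs) (∑ G xs))) y y∈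
    where
    slack : ∀ a b c d → c - d ≡ ((a + c) - (b + d)) + (b - a)
    slack = solve-∀

  ∑-+ : ∀ (F G : A → ℤ) xs → ∑ (λ x → F x + G x) xs ≡ ∑ F xs + ∑ G xs
  ∑-+ F G []       = refl
  ∑-+ F G (x ∷ xs) = trans (cong (λ s → F x + G x + s) (∑-+ F G xs))
    (interchange (F x) (G x) (∑ F xs) (∑ G xs))
    where
    interchange : ∀ a b c d → a + b + (c + d) ≡ (a + c) + (b + d)
    interchange = solve-∀

  ∑-const : ∀ c (xs : List A) → ∑ (λ _ → c) xs ≡ + List.length xs * c
  ∑-const c []       = sym (ℤₚ.*-zeroˡ c)
  ∑-const c (x ∷ xs) = trans (cong (λ s → c + s) (∑-const c xs))
    (sym (ℤₚ.suc-* (+ List.length xs) c))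

  ∑-map : ∀ {C : Set} (F : C → ℤ) (f : A → C) xs → ∑ F (List.map f xs) ≡ ∑ (F ∘ f) xs
  ∑-map F f xs = cong (List.foldr _+_ 0ℤ) (sym (Listₚ.map-∘ xs))

indicator : {P : Set} → Dec P → ℤ
indicator d = if ⌊ d ⌋ then 1ℤ else 0ℤ

∑-indicator-∉ : ∀ {n} (z : ℤ^ n) xs → z ∉ xs → ∑ (λ y → indicator (y ≟ z)) xs ≡ 0ℤ
∑-indicator-∉ z []       z∉ = refl
∑-indicator-∉ z (x ∷ xs) z∉ with x ≟ z
... | yes refl = contradiction (here refl) z∉
... | no  _    = trans (ℤₚ.+-identityˡ _) (∑-indicator-∉ z xs (z∉ ∘ there))

∑-indicator-∈ : ∀ {n} (z : ℤ^ n) xs → Unique xs → z ∈ xs →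
                ∑ (λ y → indicator (y ≟ z)) xs ≡ 1ℤ
∑-indicator-∈ z (x ∷ xs) (x≢ ∷ uniq) z∈ with x ≟ z | z∈
... | yes refl | _         =
  cong (λ s → 1ℤ + s) (∑-indicator-∉ z xs λ z∈xs → All.lookup x≢ z∈xs refl)
... | no x≢z   | here z≡x  = contradiction (sym z≡x) x≢z
... | no x≢z   | there z∈xs = trans (ℤₚ.+-identityˡ _) (∑-indicator-∈ z xs uniq z∈xs)

-- Lattice vectors, the pairing with `p`, and neighbours

⊖-⊕-cancel : ∀ {n} (x v : ℤ^ n) → (x ⊖ v) ⊕ v ≡ x
⊖-⊕-cancel []      []      = refl
⊖-⊕-cancel (a ∷ x) (b ∷ v) = cong₂ _∷_ (eq a b) (⊖-⊕-cancel x v)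
  where
  eq : ∀ a b → a - b + b ≡ a
  eq = solve-∀

⊕-⊖-cancel : ∀ {n} (x y : ℤ^ n) → x ⊕ (y ⊖ x) ≡ y
⊕-⊖-cancel []      []      = refl
⊕-⊖-cancel (a ∷ x) (b ∷ y) = cong₂ _∷_ (eq a b) (⊕-⊖-cancel x y)
  where
  eq : ∀ a b → a + (b - a) ≡ b
  eq = solve-∀

⊕-identityʳ : ∀ {n} (x : ℤ^ n) → x ⊕ replicate n 0ℤ ≡ x
⊕-identityʳ []      = refl
⊕-identityʳ (a ∷ x) = cong₂ _∷_ (ℤₚ.+-identityʳ a) (⊕-identityʳ x)

⊖-identityʳ : ∀ {n} (x : ℤ^ n) → x ⊖ replicate n 0ℤ ≡ x
⊖-identityʳ []      = refl
⊖-identityʳ (a ∷ x) = cong₂ _∷_ (ℤₚ.+-identityʳ a) (⊖-identityʳ x)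

⊕-neg : ∀ {n} (x v : ℤ^ n) → x ⊕ (-1ℤ · v) ≡ x ⊖ v
⊕-neg []      []      = refl
⊕-neg (a ∷ x) (b ∷ v) = cong₂ _∷_ (cong (λ s → a + s) (ℤₚ.-1*i≡-i b)) (⊕-neg x v)

∙-⊕ : ∀ {n} (p x y : ℤ^ n) → p ∙ (x ⊕ y) ≡ p ∙ x + p ∙ y
∙-⊕ []      []      []      = refl
∙-⊕ (c ∷ p) (a ∷ x) (b ∷ y) = trans (cong (λ s → c * (a + b) + s) (∙-⊕ p x y))
  (eq a b c (p ∙ x) (p ∙ y))
  where
  eq : ∀ a b c s t → c * (a + b) + (s + t) ≡ (c * a + s) + (c * b + t)
  eq = solve-∀

∙-·ʳ : ∀ {n} k (p x : ℤ^ n) → p ∙ (k · x) ≡ k * (p ∙ x)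
∙-·ʳ k []      []      = sym (ℤₚ.*-zeroʳ k)
∙-·ʳ k (c ∷ p) (a ∷ x) = trans (cong (λ s → c * (k * a) + s) (∙-·ʳ k p x)) (eq k a c (p ∙ x))
  where
  eq : ∀ k a c s → c * (k * a) + k * s ≡ k * (c * a + s)
  eq = solve-∀

∙-·ˡ : ∀ {n} k (p x : ℤ^ n) → (k · p) ∙ x ≡ k * (p ∙ x)
∙-·ˡ k []      []      = sym (ℤₚ.*-zeroʳ k)
∙-·ˡ k (c ∷ p) (a ∷ x) = trans (cong (λ s → k * c * a + s) (∙-·ˡ k p x)) (eq k a c (p ∙ x))
  where
  eq : ∀ k a c s → k * c * a + k * s ≡ k * (c * a + s)
  eq = solve-∀

∙-⊖ : ∀ {n} (p x y : ℤ^ n) → p ∙ (x ⊖ y) ≡ p ∙ x - p ∙ y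
∙-⊖ p x y = trans (cong (p ∙_) (sym (⊕-neg x y))) (trans (∙-⊕ p x _)
  (cong (λ s → p ∙ x + s) (trans (∙-·ʳ -1ℤ p y) (ℤₚ.-1*i≡-i (p ∙ y)))))

neighbours-⊕ : ∀ {n} (x v : ℤ^ n) → neighbours (x ⊕ v) ≡ List.map (_⊕ v) (neighbours x)
neighbours-⊕ []      []      = refl
neighbours-⊕ (a ∷ x) (b ∷ v) = cong₂ _∷_ (cong (_∷ x ⊕ v) (shift a b 1ℤ))
  (cong₂ _∷_ (cong (_∷ x ⊕ v) (shift a b -1ℤ))
    (trans (cong (List.map (a + b ∷_)) (neighbours-⊕ x v))
      (trans (sym (Listₚ.map-∘ (neighbours x))) (Listₚ.map-∘ (neighbours x)))))
  where
  shift : ∀ a b c → a + b + c ≡ a + c + b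
  shift = solve-∀

∈-neighbours-⊕ : ∀ {n} {x y : ℤ^ n} v → y ∈ neighbours x → y ⊕ v ∈ neighbours (x ⊕ v)
∈-neighbours-⊕ {x = x} v y∈ = subst (_ ∈_) (sym (neighbours-⊕ x v)) (∈-map⁺ (_⊕ v) y∈)

length-neighbours : ∀ {n} (x : ℤ^ n) → List.length (neighbours x) ≡ 2 ℕ.* n
length-neighbours []              = refl
length-neighbours {suc n} (a ∷ x) = trans
  (cong (suc ∘ suc) (trans (Listₚ.length-map (a ∷_) (neighbours x)) (length-neighbours x)))
  (sym (ℕₚ.*-suc 2 n))

∑-neighbours-const : ∀ {n} c (x : ℤ^ n) → ∑ (λ _ → c) (neighbours x) ≡ + (2 ℕ.* n) * c
∑-neighbours-const c x = trans (∑-const c (neighbours x))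
  (cong (λ m → + m * c) (length-neighbours x))

∑-neighbours-linear : ∀ {n} (p x : ℤ^ n) → ∑ (p ∙_) (neighbours x) ≡ + (2 ℕ.* n) * (p ∙ x)
∑-neighbours-linear []      []              = refl
∑-neighbours-linear {suc n} (c ∷ p) (a ∷ x) = begin
  c * (a + 1ℤ) + p ∙ x + (c * (a - 1ℤ) + p ∙ x + ∑ ((c ∷ p) ∙_) (List.map (a ∷_) (neighbours x)))
    ≡⟨ cong (λ s → c * (a + 1ℤ) + p ∙ x + (c * (a - 1ℤ) + p ∙ x + s))
         (trans (∑-map ((c ∷ p) ∙_) (a ∷_) (neighbours x))
         (trans (∑-+ (λ _ → c * a) (p ∙_) (neighbours x))
                (cong₂ _+_ (∑-neighbours-const (c * a) x) (∑-neighbours-linear p x)))) ⟩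
  c * (a + 1ℤ) + p ∙ x + (c * (a - 1ℤ) + p ∙ x + (+ (2 ℕ.* n) * (c * a) + + (2 ℕ.* n) * (p ∙ x)))
    ≡⟨ eq a c (p ∙ x) (+ (2 ℕ.* n)) ⟩
  (+ 2 + + (2 ℕ.* n)) * (c * a + p ∙ x)
    ≡⟨ cong (λ m → + m * (c * a + p ∙ x)) (sym (ℕₚ.*-suc 2 n)) ⟩
  + (2 ℕ.* suc n) * (c * a + p ∙ x) ∎
  where
  open ≡-Reasoning
  eq : ∀ a c s m → c * (a + 1ℤ) + s + (c * (a - 1ℤ) + s + (m * (c * a) + m * s)) ≡
                   (+ 2 + m) * (c * a + s)
  eq = solve-∀

-- The discrete Laplacian and its extremum principles

module _ {n : ℕ} where

  Δ-+ : ∀ (F G : ℤ^ n → ℤ) z → Δ (λ x → F x + G x) z ≡ Δ F z + Δ G z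
  Δ-+ F G z = trans (cong (λ s → - + (2 ℕ.* n) * (F z + G z) + s) (∑-+ F G (neighbours z)))
    (eq (- + (2 ℕ.* n)) (F z) (G z) (∑ F (neighbours z)) (∑ G (neighbours z)))
    where
    eq : ∀ m a b s t → m * (a + b) + (s + t) ≡ (m * a + s) + (m * b + t)
    eq = solve-∀

  Δ-mono-≤ : ∀ {F G : ℤ^ n → ℤ} z → F z ≡ G z →
             (∀ y → y ∈ neighbours z → F y ≤ G y) → Δ F z ≤ Δ G z
  Δ-mono-≤ {F} {G} z Fz≡Gz F≤G = subst (λ a → Δ F z ≤ - + (2 ℕ.* n) * a + ∑ G (neighbours z))
    Fz≡Gz (ℤₚ.+-monoʳ-≤ (- + (2 ℕ.* n) * F z) (∑-mono-≤ (neighbours z) F≤G))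

  Δ-cong-local : ∀ {F G : ℤ^ n → ℤ} z → F z ≡ G z →
                 (∀ y → y ∈ neighbours z → F y ≡ G y) → Δ F z ≡ Δ G z
  Δ-cong-local z Fz≡Gz F≡G = ℤₚ.≤-antisym
    (Δ-mono-≤ z Fz≡Gz λ y y∈ → ℤₚ.≤-reflexive (F≡G y y∈))
    (Δ-mono-≤ z (sym Fz≡Gz) λ y y∈ → ℤₚ.≤-reflexive (sym (F≡G y y∈)))

  Δ-cong : ∀ {F G : ℤ^ n → ℤ} → (∀ x → F x ≡ G x) → ∀ z → Δ F z ≡ Δ G z
  Δ-cong F≡G z = Δ-cong-local z (F≡G z) λ y _ → F≡G y

  Δ-const : ∀ c (z : ℤ^ n) → Δ (λ _ → c) z ≡ 0ℤ
  Δ-const c z = trans (cong (λ s → - + (2 ℕ.* n) * c + s) (∑-neighbours-const c z))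
    (eq (+ (2 ℕ.* n)) c)
    where
    eq : ∀ m c → - m * c + m * c ≡ 0ℤ
    eq = solve-∀

  Δ-linear : ∀ (p z : ℤ^ n) → Δ (p ∙_) z ≡ 0ℤ
  Δ-linear p z = trans (cong (λ s → - + (2 ℕ.* n) * (p ∙ z) + s) (∑-neighbours-linear p z))
    (eq (+ (2 ℕ.* n)) (p ∙ z))
    where
    eq : ∀ m c → - m * c + m * c ≡ 0ℤ
    eq = solve-∀

  Δ-⊕ : ∀ (F : ℤ^ n → ℤ) z v → Δ F (z ⊕ v) ≡ Δ (λ x → F (x ⊕ v)) z
  Δ-⊕ F z v = cong (λ s → - + (2 ℕ.* n) * F (z ⊕ v) + s)
    (trans (cong (∑ F) (neighbours-⊕ z v)) (∑-map F (_⊕ v) (neighbours z)))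

  Δ≡∑-∑ : ∀ (F : ℤ^ n → ℤ) z →
           Δ F z ≡ ∑ F (neighbours z) - ∑ (λ _ → F z) (neighbours z)
  Δ≡∑-∑ F z = trans (eq (+ (2 ℕ.* n)) (F z) (∑ F (neighbours z)))
    (cong (λ s → ∑ F (neighbours z) - s) (sym (∑-neighbours-const (F z) z)))
    where
    eq : ∀ m c s → - m * c + s ≡ s - m * c
    eq = solve-∀

  -- Superharmonicity bounds the sum over the neighbours by that of the constant `G z`, while each
  -- term is at least `G z`; hence no term has slack.
  minimum-principle : ∀ {G : ℤ^ n → ℤ} z → Δ G z ≤ 0ℤ →
    (∀ y → y ∈ neighbours z → G z ≤ G y) → ∀ y → y ∈ neighbours z → G y ≡ G z
  minimum-principle {G} z ΔG≤0 Gz≤G y y∈ = sym (∑-tight (neighbours z) Gz≤G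
    (ℤₚ.i-j≤0⇒i≤j (subst (_≤ 0ℤ) (Δ≡∑-∑ G z) ΔG≤0)) y y∈)

  maximum-principle : ∀ {G : ℤ^ n → ℤ} z → 0ℤ ≤ Δ G z →
    (∀ y → y ∈ neighbours z → G y ≤ G z) → ∀ y → y ∈ neighbours z → G y ≡ G z
  maximum-principle {G} z 0≤ΔG G≤Gz = ∑-tight (neighbours z) G≤Gz
    (ℤₚ.0≤i-j⇒j≤i (subst (0ℤ ≤_) (Δ≡∑-∑ G z) 0≤ΔG))

  ⊓-superharmonic : ∀ {F G : ℤ^ n → ℤ} → Superharmonic F → Superharmonic G →
                    Superharmonic (λ z → F z ⊓ G z)
  ⊓-superharmonic {F} {G} sF sG z with ℤₚ.⊓-sel (F z) (G z)
  ... | inj₁ eq = ℤₚ.≤-trans (Δ-mono-≤ z eq λ y _ → ℤₚ.i⊓j≤i (F y) (G y)) (sF z)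
  ... | inj₂ eq = ℤₚ.≤-trans (Δ-mono-≤ z eq λ y _ → ℤₚ.i⊓j≤j (F y) (G y)) (sG z)

-- Euclidean distance against differences of levels of `p`

∥_∥ : ∀ {n} → ℤ^ n → ℕ
∥ x ∥ = Vec.sum (Vec.map ∣_∣ x)

square-cancel-≤ : ∀ {a b} → a ℕ.^ 2 ℕ.≤ b ℕ.^ 2 → a ℕ.≤ b
square-cancel-≤ a²≤b² = ℕₚ.≮⇒≥ λ b<a → ℕₚ.<⇒≱ (ℕₚ.^-monoˡ-< 2 b<a) a²≤b²

∣∙∣-lipschitz : ∀ {n} (p x y : ℤ^ n) {C} → dist² x y ℕ.≤ C ℕ.^ 2 →
                ∣ p ∙ x - p ∙ y ∣ ℕ.≤ ∥ p ∥ ℕ.* C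
∣∙∣-lipschitz []      []      []      d≤ = ℕ.z≤n
∣∙∣-lipschitz (c ∷ p) (a ∷ x) (b ∷ y) {C} d≤ = begin
  ∣ c * a + p ∙ x - (c * b + p ∙ y) ∣      ≡⟨ cong ∣_∣ (eq c a b (p ∙ x) (p ∙ y)) ⟩
  ∣ c * (a - b) + (p ∙ x - p ∙ y) ∣        ≤⟨ ℤₚ.∣i+j∣≤∣i∣+∣j∣ (c * (a - b)) _ ⟩
  ∣ c * (a - b) ∣ ℕ.+ ∣ p ∙ x - p ∙ y ∣    ≡⟨ cong (ℕ._+ _) (ℤₚ.∣i*j∣≡∣i∣*∣j∣ c (a - b)) ⟩
  ∣ c ∣ ℕ.* ∣ a - b ∣ ℕ.+ ∣ p ∙ x - p ∙ y ∣
    ≤⟨ ℕₚ.+-mono-≤ (ℕₚ.*-monoʳ-≤ ∣ c ∣ (square-cancel-≤ (ℕₚ.m+n≤o⇒m≤o _ d≤)))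
         (∣∙∣-lipschitz p x y (ℕₚ.m+n≤o⇒n≤o (∣ a - b ∣ ℕ.^ 2) d≤)) ⟩
  ∣ c ∣ ℕ.* C ℕ.+ ∥ p ∥ ℕ.* C              ≡⟨ sym (ℕₚ.*-distribʳ-+ C ∣ c ∣ ∥ p ∥) ⟩
  (∣ c ∣ ℕ.+ ∥ p ∥) ℕ.* C                  ∎
  where
  open ℕₚ.≤-Reasoning
  eq : ∀ c a b s t → c * a + s - (c * b + t) ≡ c * (a - b) + (s - t)
  eq = solve-∀

∙-lower : ∀ {n} (p x y : ℤ^ n) {C} → dist² x y ℕ.≤ C ℕ.^ 2 →
          p ∙ x - + (∥ p ∥ ℕ.* C) ≤ p ∙ y
∙-lower p x y {C} d≤ = ≤-by₂ (i≤+∣i∣ (p ∙ x - p ∙ y)) (+≤+ (∣∙∣-lipschitz p x y {C} d≤))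
  (slack (p ∙ x) (p ∙ y) (+ ∣ p ∙ x - p ∙ y ∣) (+ (∥ p ∥ ℕ.* C)))
  where
  slack : ∀ a b m k → b - (a - k) ≡ m - (a - b) + (k - m)
  slack = solve-∀

∙-upper : ∀ {n} (p x y : ℤ^ n) {C} → dist² x y ℕ.≤ C ℕ.^ 2 →
          p ∙ y ≤ p ∙ x + + (∥ p ∥ ℕ.* C)
∙-upper p x y {C} d≤ = ≤-by₂ (-∣i∣≤i (p ∙ x - p ∙ y)) (+≤+ (∣∙∣-lipschitz p x y {C} d≤))
  (slack (p ∙ x) (p ∙ y) (+ ∣ p ∙ x - p ∙ y ∣) (+ (∥ p ∥ ℕ.* C)))
  where
  slack : ∀ a b m k → a + k - b ≡ (a - b) - - m + (k - m)
  slack = solve-∀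

neighbour-dist : ∀ {n} {x y : ℤ^ n} → y ∈ neighbours x → dist² x y ℕ.≤ 1 ℕ.^ 2
neighbour-dist y∈ = ℕₚ.≤-reflexive (∈-neighbours⇒~ _ _ y∈)

neighbour-lower : ∀ {n} (p : ℤ^ n) {x y} → y ∈ neighbours x → p ∙ x - + ∥ p ∥ ≤ p ∙ y
neighbour-lower p y∈ = subst (λ m → p ∙ _ - + m ≤ p ∙ _) (ℕₚ.*-identityʳ ∥ p ∥)
  (∙-lower p _ _ {1} (neighbour-dist y∈))

neighbour-upper : ∀ {n} (p : ℤ^ n) {x y} → y ∈ neighbours x → p ∙ y ≤ p ∙ x + + ∥ p ∥
neighbour-upper p y∈ = subst (λ m → p ∙ _ ≤ p ∙ _ + + m) (ℕₚ.*-identityʳ ∥ p ∥)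
  (∙-upper p _ _ {1} (neighbour-dist y∈))

dist²-⊕-· : ∀ {n} (x q : ℤ^ n) k → dist² x (x ⊕ k · q) ℕ.≤ (∣ k ∣ ℕ.* ∥ q ∥) ℕ.^ 2
dist²-⊕-· []      []      k = ℕ.z≤n
dist²-⊕-· (a ∷ x) (b ∷ q) k = begin
  ∣ a - (a + k * b) ∣ ℕ.^ 2 ℕ.+ dist² x (x ⊕ k · q)
    ≡⟨ cong (λ m → m ℕ.^ 2 ℕ.+ dist² x (x ⊕ k · q))
         (trans (cong ∣_∣ (eq a (k * b))) (trans (ℤₚ.∣-i∣≡∣i∣ (k * b)) (ℤₚ.∣i*j∣≡∣i∣*∣j∣ k b))) ⟩
  (∣ k ∣ ℕ.* ∣ b ∣) ℕ.^ 2 ℕ.+ dist² x (x ⊕ k · q)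
    ≤⟨ ℕₚ.+-monoʳ-≤ ((∣ k ∣ ℕ.* ∣ b ∣) ℕ.^ 2) (dist²-⊕-· x q k) ⟩
  (∣ k ∣ ℕ.* ∣ b ∣) ℕ.^ 2 ℕ.+ (∣ k ∣ ℕ.* ∥ q ∥) ℕ.^ 2
    ≤⟨ squares (∣ k ∣ ℕ.* ∣ b ∣) (∣ k ∣ ℕ.* ∥ q ∥) ⟩
  (∣ k ∣ ℕ.* ∣ b ∣ ℕ.+ ∣ k ∣ ℕ.* ∥ q ∥) ℕ.^ 2
    ≡⟨ cong (ℕ._^ 2) (sym (ℕₚ.*-distribˡ-+ ∣ k ∣ ∣ b ∣ ∥ q ∥)) ⟩
  (∣ k ∣ ℕ.* (∣ b ∣ ℕ.+ ∥ q ∥)) ℕ.^ 2 ∎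
  where
  open ℕₚ.≤-Reasoning
  eq : ∀ a b → a - (a + b) ≡ - b
  eq = solve-∀
  expand : ∀ s t → (s ℕ.+ t) ℕ.* ((s ℕ.+ t) ℕ.* 1) ≡
                   s ℕ.* (s ℕ.* 1) ℕ.+ t ℕ.* (t ℕ.* 1) ℕ.+ 2 ℕ.* s ℕ.* t
  expand = ℕ-solve-∀
  squares : ∀ s t → s ℕ.^ 2 ℕ.+ t ℕ.^ 2 ℕ.≤ (s ℕ.+ t) ℕ.^ 2
  squares s t = subst (s ℕ.^ 2 ℕ.+ t ℕ.^ 2 ℕ.≤_) (sym (expand s t)) (ℕₚ.m≤m+n _ _)

-- d is ± a coordinate vector.
record Ascent {n} (p d : ℤ^ n) : Set where
  field
    ascends : 1ℤ ≤ p ∙ d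
    up      : ∀ z → z ⊕ d ∈ neighbours z
    down    : ∀ z → z ⊖ d ∈ neighbours z

∙-zeroʳ : ∀ {n} (p : ℤ^ n) → p ∙ replicate n 0ℤ ≡ 0ℤ
∙-zeroʳ []      = refl
∙-zeroʳ (c ∷ p) = cong₂ _+_ (ℤₚ.*-zeroʳ c) (∙-zeroʳ p)

-- The vector `q` only certifies that `p` has a nonzero coordinate: skipping a zero coordinate does
-- not change the pairing, and the first nonzero one gives `d` with its sign.
ascent : ∀ {n} (p q : ℤ^ n) → p ∙ q ≢ 0ℤ → ∃[ d ] Ascent p d
ascent []      []      p∙q≢0 = contradiction refl p∙q≢0
ascent {suc n} (+ suc c ∷ p) q p∙q≢0 = 1ℤ ∷ replicate n 0ℤ , record
  { ascends = subst (1ℤ ≤_)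
      (sym (trans (cong₂ _+_ (ℤₚ.*-identityʳ (+ suc c)) (∙-zeroʳ p)) (ℤₚ.+-identityʳ _)))
      (+≤+ (ℕ.s≤s ℕ.z≤n))
  ; up      = λ { (a ∷ z) → here (cong (a + 1ℤ ∷_) (⊕-identityʳ z)) }
  ; down    = λ { (a ∷ z) → there (here (cong (a - 1ℤ ∷_) (⊖-identityʳ z))) }
  }
ascent {suc n} (-[1+ c ] ∷ p) q p∙q≢0 = -1ℤ ∷ replicate n 0ℤ , record
  { ascends = subst (1ℤ ≤_)
      (sym (trans (cong₂ _+_ (trans (ℤₚ.*-comm -[1+ c ] -1ℤ) (ℤₚ.-1*i≡-i -[1+ c ])) (∙-zeroʳ p))
                  (ℤₚ.+-identityʳ _)))
      (+≤+ (ℕ.s≤s ℕ.z≤n))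
  ; up      = λ { (a ∷ z) → there (here (cong (a - 1ℤ ∷_) (⊕-identityʳ z))) }
  ; down    = λ { (a ∷ z) → here (cong (a + 1ℤ ∷_) (⊖-identityʳ z)) }
  }
ascent {suc n} (+ 0 ∷ p) (b ∷ q) p∙q≢0 with ascent p q
  (p∙q≢0 ∘ trans (trans (cong (_+ p ∙ q) (ℤₚ.*-zeroˡ b)) (ℤₚ.+-identityˡ (p ∙ q))))
... | d , A = 0ℤ ∷ d , record
  { ascends = subst (1ℤ ≤_) (sym (ℤₚ.+-identityˡ (p ∙ d))) (Ascent.ascends A)
  ; up      = λ { (a ∷ z) → subst (λ b → b ∷ z ⊕ d ∈ neighbours (a ∷ z))
      (sym (ℤₚ.+-identityʳ a)) (there (there (∈-map⁺ (a ∷_) (Ascent.up A z)))) }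
  ; down    = λ { (a ∷ z) → subst (λ b → b ∷ z ⊖ d ∈ neighbours (a ∷ z))
      (sym (ℤₚ.+-identityʳ a)) (there (there (∈-map⁺ (a ∷_) (Ascent.down A z)))) }
  }

-- The function `Ψ`

module _ {n} (p : ℤ^ n) where

  Ψ≤0 : ∀ z → Ψ p z ≤ 0ℤ
  Ψ≤0 z = ℤₚ.i⊓j≤i 0ℤ (p ∙ z)

  Ψ≡0 : ∀ {z} → 0ℤ ≤ p ∙ z → Ψ p z ≡ 0ℤ
  Ψ≡0 = ℤₚ.i≤j⇒i⊓j≡i

  Ψ≡∙ : ∀ {z} → p ∙ z ≤ 0ℤ → Ψ p z ≡ p ∙ z
  Ψ≡∙ = ℤₚ.i≥j⇒i⊓j≡j

  Ψ-superharmonic : Superharmonic (Ψ p)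
  Ψ-superharmonic = ⊓-superharmonic
    (λ z → ℤₚ.≤-reflexive (Δ-const 0ℤ z)) (λ z → ℤₚ.≤-reflexive (Δ-linear p z))

  D-Ψ-upper : ∀ s → D (Ψ p) s → p ∙ s ≤ + ∥ p ∥
  D-Ψ-upper s ΔΨ≢0 = ℤₚ.≮⇒≥ λ ∥p∥<p∙s → ΔΨ≢0 (trans
    (Δ-cong-local s (Ψ≡0 (ℤₚ.≤-trans (+≤+ ℕ.z≤n) (ℤₚ.<⇒≤ ∥p∥<p∙s)))
      λ y y∈ → Ψ≡0 (≤-by₂ (ℤₚ.<⇒≤ ∥p∥<p∙s) (neighbour-lower p y∈) (slack (+ ∥ p ∥) (p ∙ s) (p ∙ y))))
    (Δ-const 0ℤ s))
    where
    slack : ∀ m a b → b - 0ℤ ≡ (a - m) + (b - (a - m))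
    slack = solve-∀

-- The husking vanishes from a uniform level on

module ZeroSide {n} (p q : ℤ^ n) (p∙q≡1 : p ∙ q ≡ 1ℤ)
                (ψ : ℤ^ n → ℤ) (canonical : IsCanonicalHusking p ψ) where

  K : ℕ
  K = proj₁ canonical

  minimizer : ∀ z → ∃[ G ] (Θ K (Ψ p) G × G z ≡ ψ z)
  minimizer z = proj₁ (proj₂ canonical K ℕₚ.≤-refl z)

  minimal : ∀ {k G} → K ℕ.≤ k → Θ k (Ψ p) G → ∀ z → ψ z ≤ G z
  minimal K≤k θ z = proj₂ (proj₂ canonical _ K≤k z) _ θ

  ψ-superharmonic : Superharmonic ψ
  ψ-superharmonic z with minimizer z
  ... | G , θ , Gz≡ψz = ℤₚ.≤-trans
    (Δ-mono-≤ z (sym Gz≡ψz) λ y _ → minimal ℕₚ.≤-refl θ y) (Θ.superharmonic θ z)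

  ψ-lower : ∀ z → Ψ p z - + K ≤ ψ z
  ψ-lower z with minimizer z
  ... | G , θ , Gz≡ψz = subst (Ψ p z - + K ≤_) Gz≡ψz (Θ.lower θ z)

  ψ-upper : ∀ z → ψ z ≤ Ψ p z
  ψ-upper z with minimizer z
  ... | G , θ , Gz≡ψz = subst (_≤ Ψ p z) Gz≡ψz (Θ.upper θ z)

  ψ≤0 : ∀ z → ψ z ≤ 0ℤ
  ψ≤0 z = ℤₚ.≤-trans (ψ-upper z) (Ψ≤0 p z)

  private
    d-ascent : ∃[ d ] Ascent p d
    d-ascent = ascent p q λ p∙q≡0 → contradiction (trans (sym p∙q≡1) p∙q≡0) λ ()

  d : ℤ^ n
  d = proj₁ d-ascent

  open Ascent (proj₂ d-ascent) public

  ascends-⊕ : ∀ y → 1ℤ + p ∙ y ≤ p ∙ (y ⊕ d)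
  ascends-⊕ y = ≤-by₁ ascends (trans (cong (_- (1ℤ + p ∙ y)) (∙-⊕ p y d)) (eq (p ∙ y) (p ∙ d)))
    where
    eq : ∀ a b → a + b - (1ℤ + a) ≡ b - 1ℤ
    eq = solve-∀

  -- A minimizer G at z vanishes far up; by the minimum principle a negative
  -- value G z is propagated upwards until some neighbour has a smaller one.
  descent : ∀ z → ψ z < 0ℤ → ∃[ y ] (p ∙ z - + ∥ p ∥ ≤ p ∙ y × ψ y < ψ z)
  descent z ψz<0 with minimizer z
  ... | G , θ , Gz≡ψz = walk ∣ + b - p ∙ z ∣ z ℤₚ.≤-refl
    (≤-by₁ (i≤+∣i∣ (+ b - p ∙ z)) (slack₀ (+ b) (p ∙ z) _)) Gz≡ψz
    where
    C b : ℕ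
    C = proj₁ (Θ.near θ)
    -- `D (Ψ p)` reaches at most level `∥ p ∥`, and distance `C` adds at most `∥ p ∥ * C` levels;
    -- one level more and `G` must equal `Ψ`, that is, 0.
    b = suc (∥ p ∥ ℕ.+ ∥ p ∥ ℕ.* C)
    slack₀ : ∀ b a m → a + m - b ≡ m - (b - a)
    slack₀ = solve-∀
    G≡0 : ∀ y → + b ≤ p ∙ y → G y ≡ 0ℤ
    G≡0 y b≤p∙y with Ψ p y ℤₚ.≟ G y
    ... | yes Ψ≡G = trans (sym Ψ≡G) (Ψ≡0 p (ℤₚ.≤-trans (+≤+ ℕ.z≤n) b≤p∙y))
    ... | no  Ψ≢G with proj₂ (proj₂ (Θ.near θ)) y Ψ≢G
    ... | s , s∈D , near = contradiction
      (≤-by₃ b≤p∙y (∙-lower p y s {C} near) (D-Ψ-upper p s s∈D)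
        (slack (p ∙ y) (p ∙ s) (+ ∥ p ∥) (+ (∥ p ∥ ℕ.* C)))) 1≰0
      where
      slack : ∀ y s P PC → 0ℤ - 1ℤ ≡ y - (1ℤ + (P + PC)) + (s - (y - PC)) + (P - s)
      slack = solve-∀
    walk : ∀ fuel y → p ∙ z ≤ p ∙ y → + b ≤ p ∙ y + + fuel → G y ≡ ψ z →
           ∃[ y ] (p ∙ z - + ∥ p ∥ ≤ p ∙ y × ψ y < ψ z)
    walk zero y _ b≤ Gy≡ψz = contradiction
      (trans (sym Gy≡ψz) (G≡0 y (subst (+ b ≤_) (ℤₚ.+-identityʳ (p ∙ y)) b≤)))
      (ℤₚ.<⇒≢ ψz<0)
    walk (suc fuel) y z≤y b≤ Gy≡ψz with any? (λ x → G x ℤₚ.<? ψ z) (neighbours y)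
    ... | yes found with find found
    ... | x , x∈ , Gx<ψz = x
      , ≤-by₂ z≤y (neighbour-lower p x∈) (slack (p ∙ z) (p ∙ y) (p ∙ x) (+ ∥ p ∥))
      , ℤₚ.≤-<-trans (minimal ℕₚ.≤-refl θ x) Gx<ψz
      where
      slack : ∀ z y x P → x - (z - P) ≡ y - z + (x - (y - P))
      slack = solve-∀
    walk (suc fuel) y z≤y b≤ Gy≡ψz | no none = walk fuel (y ⊕ d)
      (≤-by₃ z≤y (ascends-⊕ y) (+≤+ {0} {1} ℕ.z≤n) (slack₁ (p ∙ z) (p ∙ y) (p ∙ (y ⊕ d))))
      (≤-by₂ b≤ (ascends-⊕ y) (slack₂ (p ∙ y) (p ∙ (y ⊕ d)) (+ b) (+ fuel)))
      (trans (minimum-principle y (Θ.superharmonic θ y)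
               (λ x x∈ → subst (_≤ G x) (sym Gy≡ψz) (ℤₚ.≮⇒≥ λ Gx<ψz → none (lose x∈ Gx<ψz)))
               (y ⊕ d) (up y))
             Gy≡ψz)
      where
      slack₁ : ∀ z y x → x - z ≡ y - z + (x - (1ℤ + y)) + (1ℤ - 0ℤ)
      slack₁ = solve-∀
      slack₂ : ∀ y x b f → x + f - b ≡ y + (1ℤ + f) - b + (x - (1ℤ + y))
      slack₂ = solve-∀

  -- A negative value at level `(k + 1) ∥ p ∥` or higher yields, by `descent`, a strictly smaller
  -- value at level `k ∥ p ∥` or higher, to which the bound for `k` applies. The start is
  -- `Ψ - K ≤ ψ`; at `k = K` the bound becomes 0, uniformly in `z`.
  ψ-climbs : ∀ k → k ℕ.≤ K → ∀ z → + (k ℕ.* ∥ p ∥) ≤ p ∙ z → + k - + K ≤ ψ z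
  ψ-climbs zero    _   z 0≤p∙z = subst (λ a → a - + K ≤ ψ z) (Ψ≡0 p 0≤p∙z) (ψ-lower z)
  ψ-climbs (suc k) k<K z k≤p∙z with ψ z ℤₚ.<? 0ℤ
  ... | no  ψz≮0 = ≤-by₂ (ℤₚ.≮⇒≥ ψz≮0) (+≤+ k<K) (slack (ψ z) (+ suc k) (+ K))
    where
    slack : ∀ a k K → a - (k - K) ≡ a - 0ℤ + (K - k)
    slack = solve-∀
  ... | yes ψz<0 with descent z ψz<0
  ... | y , y≥ , ψy<ψz = ≤-by₂
    (ψ-climbs k (ℕₚ.<⇒≤ k<K) y
      (≤-by₂ k≤p∙z y≥ (slack₁ (+ ∥ p ∥) (+ (k ℕ.* ∥ p ∥)) (p ∙ z) (p ∙ y))))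
    (ℤₚ.i<j⇒suc[i]≤j ψy<ψz) (slack₂ (+ k) (+ K) (ψ y) (ψ z))
    where
    slack₁ : ∀ P kP z y → y - kP ≡ z - (P + kP) + (y - (z - P))
    slack₁ = solve-∀
    slack₂ : ∀ k K a b → b - ((1ℤ + k) - K) ≡ a - (k - K) + (b - (1ℤ + a))
    slack₂ = solve-∀

  ψ≡0 : ∀ z → + (K ℕ.* ∥ p ∥) ≤ p ∙ z → ψ z ≡ 0ℤ
  ψ≡0 z z≥ = ℤₚ.≤-antisym (ψ≤0 z)
    (subst (_≤ ψ z) (ℤₚ.+-inverseʳ (+ K)) (ψ-climbs K ℕₚ.≤-refl z z≥))

-- The symmetry between `p` and `- p`

Θ-+-harmonic : ∀ {n k} {F F′ L G : ℤ^ n → ℤ} →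
               (∀ z → Δ L z ≡ 0ℤ) → (∀ z → F′ z ≡ F z + L z) →
               Θ k F G → Θ k F′ (λ z → G z + L z)
Θ-+-harmonic {k = k} {F} {F′} {L} {G} ΔL≡0 F′≡F+L θ = record
  { superharmonic = λ z → subst (_≤ 0ℤ) (sym (Δ-+L G z)) (superharmonic z)
  ; lower         = λ z → subst (λ a → a - + k ≤ G z + L z) (sym (F′≡F+L z))
      (≤-by₁ (lower z) (slack (F z) (L z) (G z) (+ k)))
  ; upper         = λ z → subst (G z + L z ≤_) (sym (F′≡F+L z)) (ℤₚ.+-monoˡ-≤ (L z) (upper z))
  ; near          = proj₁ near , proj₁ (proj₂ near) , λ z F′≢ →
      let s , s∈D , z~s = proj₂ (proj₂ near) z
                            (λ F≡G → F′≢ (trans (F′≡F+L z) (cong (_+ L z) F≡G)))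
      in s , (λ ΔF′≡0 → s∈D (trans (sym (trans (Δ-cong F′≡F+L s) (Δ-+L F s))) ΔF′≡0)) , z~s
  }
  where
  open Θ θ
  Δ-+L : ∀ H z → Δ (λ x → H x + L x) z ≡ Δ H z
  Δ-+L H z = trans (Δ-+ H L z)
    (trans (cong (λ a → Δ H z + a) (ΔL≡0 z)) (ℤₚ.+-identityʳ (Δ H z)))
  slack : ∀ f l g k → g + l - (f + l - k) ≡ g - (f - k)
  slack = solve-∀

neg-∙ : ∀ {n} (p z : ℤ^ n) → (-1ℤ · p) ∙ z ≡ - (p ∙ z)
neg-∙ p z = trans (∙-·ˡ -1ℤ p z) (ℤₚ.-1*i≡-i (p ∙ z))

Ψ-neg : ∀ {n} (p z : ℤ^ n) → Ψ (-1ℤ · p) z ≡ Ψ p z + (-1ℤ · p) ∙ z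
Ψ-neg p z with ℤₚ.≤-total 0ℤ (p ∙ z)
... | inj₁ 0≤p∙z = trans (Ψ≡∙ (-1ℤ · p) (subst (_≤ 0ℤ) (sym (neg-∙ p z)) (ℤₚ.neg-mono-≤ 0≤p∙z)))
  (sym (trans (cong (_+ (-1ℤ · p) ∙ z) (Ψ≡0 p 0≤p∙z)) (ℤₚ.+-identityˡ _)))
... | inj₂ p∙z≤0 = trans (Ψ≡0 (-1ℤ · p) (subst (0ℤ ≤_) (sym (neg-∙ p z)) (ℤₚ.neg-mono-≤ p∙z≤0)))
  (sym (trans (cong₂ _+_ (Ψ≡∙ p p∙z≤0) (neg-∙ p z)) (ℤₚ.+-inverseʳ (p ∙ z))))

+-neg-∙ : ∀ {n} (p z : ℤ^ n) a → a + (-1ℤ · p) ∙ z + p ∙ z ≡ a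
+-neg-∙ p z a = trans (cong (λ b → a + b + p ∙ z) (neg-∙ p z)) (eq a (p ∙ z))
  where
  eq : ∀ a b → a + - b + b ≡ a
  eq = solve-∀

-- Since min(0, -t) = min(0, t) - t, adding the harmonic function `- p ∙ z` carries the competitors
-- for `p` to those for `- p`, and adding `p ∙ z` carries them back; minima follow.
canonical-neg : ∀ {n} (p : ℤ^ n) {ψ} → IsCanonicalHusking p ψ →
                IsCanonicalHusking (-1ℤ · p) (λ z → ψ z + (-1ℤ · p) ∙ z)
canonical-neg p {ψ} (K , husking) = K , λ k K≤k z →
  (let G , θ , Gz≡ψz = proj₁ (husking k K≤k z) in
   (λ x → G x + (-1ℤ · p) ∙ x) , Θ-+-harmonic (Δ-linear (-1ℤ · p)) (Ψ-neg p) θ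
   , cong (_+ (-1ℤ · p) ∙ z) Gz≡ψz)
  , λ G θ → subst (ψ z + (-1ℤ · p) ∙ z ≤_)
      (eq (G z) (p ∙ z) ((-1ℤ · p) ∙ z) (neg-∙ p z))
      (ℤₚ.+-monoˡ-≤ ((-1ℤ · p) ∙ z) (proj₂ (husking k K≤k z) (λ x → G x + p ∙ x)
        (Θ-+-harmonic (Δ-linear p)
          (λ x → sym (trans (cong (_+ p ∙ x) (Ψ-neg p x)) (+-neg-∙ p x (Ψ p x)))) θ)))
  where
  eq : ∀ g a b → b ≡ - a → g + a + b ≡ g
  eq g a .(- a) refl = cancel g a
    where
    cancel : ∀ g a → g + a + - a ≡ g
    cancel = solve-∀

neg-∙-neg : ∀ {n} (p q : ℤ^ n) → p ∙ q ≡ 1ℤ → (-1ℤ · p) ∙ (-1ℤ · q) ≡ 1ℤ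
neg-∙-neg p q p∙q≡1 = trans (neg-∙ p (-1ℤ · q))
  (cong -_ (trans (∙-·ʳ -1ℤ p q) (cong (-1ℤ *_) p∙q≡1)))

-- Consequences of minimality

module Canonical {n} (p q : ℤ^ n) (p∙q≡1 : p ∙ q ≡ 1ℤ)
                 (ψ : ℤ^ n → ℤ) (canonical : IsCanonicalHusking p ψ) where

  open ZeroSide p q p∙q≡1 ψ canonical public

  private
    module Below = ZeroSide (-1ℤ · p) (-1ℤ · q) (neg-∙-neg p q p∙q≡1)
                            (λ z → ψ z + (-1ℤ · p) ∙ z) (canonical-neg p canonical)

  -- A sum, to dominate both thresholds: the one above for `p` and the one below, which is the
  -- threshold for `- p`.
  M : ℕ
  M = K ℕ.* ∥ p ∥ ℕ.+ Below.K ℕ.* ∥ -1ℤ · p ∥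

  ψ≡0-above : ∀ z → + M ≤ p ∙ z → ψ z ≡ 0ℤ
  ψ≡0-above z M≤ = ψ≡0 z (ℤₚ.≤-trans (+≤+ (ℕₚ.m≤m+n _ _)) M≤)

  ψ≡∙-below : ∀ z → + M ≤ - (p ∙ z) → ψ z ≡ p ∙ z
  ψ≡∙-below z M≤ = trans (sym (+-neg-∙ p z (ψ z)))
    (trans (cong (_+ p ∙ z) (Below.ψ≡0 z (subst (_ ≤_) (sym (neg-∙ p z))
             (ℤₚ.≤-trans (+≤+ (ℕₚ.m≤n+m _ _)) M≤))))
           (ℤₚ.+-identityˡ (p ∙ z)))

  +≤-⇒≤0 : ∀ {m} i → + m ≤ - i → i ≤ 0ℤ
  +≤-⇒≤0 i m≤-i = ≤-by₁ (ℤₚ.≤-trans (+≤+ ℕ.z≤n) m≤-i) (eq i)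
    where
    eq : ∀ i → 0ℤ - i ≡ - i - 0ℤ
    eq = solve-∀

  ψ≡Ψ : ∀ z → M ℕ.≤ ∣ p ∙ z ∣ → ψ z ≡ Ψ p z
  ψ≡Ψ z M≤ with ≤∣i∣-cases (p ∙ z) M≤
  ... | inj₁ above = trans (ψ≡0-above z above) (sym (Ψ≡0 p (ℤₚ.≤-trans (+≤+ ℕ.z≤n) above)))
  ... | inj₂ below = trans (ψ≡∙-below z below) (sym (Ψ≡∙ p (+≤-⇒≤0 (p ∙ z) below)))

  -- As `p ∙ q` is 1, a multiple of `q` leads to any level, over a distance proportional to the
  -- difference of levels. This turns bounds on levels into bounds on distance.
  lift : ℤ → ℤ^ n → ℤ^ n
  lift m z = z ⊕ (m - p ∙ z) · q

  ∙-lift : ∀ m z → p ∙ lift m z ≡ m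
  ∙-lift m z = trans (∙-⊕ p z _) (trans (cong (λ a → p ∙ z + a)
    (trans (∙-·ʳ (m - p ∙ z) p q) (cong ((m - p ∙ z) *_) p∙q≡1))) (eq m (p ∙ z)))
    where
    eq : ∀ m a → a + (m - a) * 1ℤ ≡ m
    eq = solve-∀

  lift-dist : ∀ m z {C} → ∣ m - p ∙ z ∣ ℕ.* ∥ q ∥ ℕ.≤ C → dist² z (lift m z) ℕ.≤ C ℕ.^ 2
  lift-dist m z ≤C = ℕₚ.≤-trans (dist²-⊕-· z q (m - p ∙ z)) (ℕₚ.^-monoˡ-≤ 2 ≤C)

  ∙-descends : ∀ z → 1ℤ + p ∙ (z ⊖ d) ≤ p ∙ z
  ∙-descends z = subst (λ a → 1ℤ + a ≤ p ∙ z) (sym (∙-⊖ p z d))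
    (≤-by₁ ascends (eq (p ∙ z) (p ∙ d)))
    where
    eq : ∀ a b → a - (1ℤ + (a - b)) ≡ b - 1ℤ
    eq = solve-∀

  -- `Ψ` attains its maximum 0 on this level; were it harmonic at `s`, it would be 0 also at
  -- `s ⊖ d`, whose level is negative.
  level-zero⊆D-Ψ : ∀ s → p ∙ s ≡ 0ℤ → D (Ψ p) s
  level-zero⊆D-Ψ s p∙s≡0 ΔΨ≡0 = contradiction
    (≤-by₂ (subst (λ a → 1ℤ + p ∙ (s ⊖ d) ≤ a) p∙s≡0 (∙-descends s))
           (subst (_≤ p ∙ (s ⊖ d)) Ψ≡0-below (ℤₚ.i⊓j≤j 0ℤ (p ∙ (s ⊖ d))))
           (eq (p ∙ (s ⊖ d)))) 1≰0
    where
    Ψs≡0 : Ψ p s ≡ 0ℤ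
    Ψs≡0 = Ψ≡0 p (ℤₚ.≤-reflexive (sym p∙s≡0))
    Ψ≡0-below : Ψ p (s ⊖ d) ≡ 0ℤ
    Ψ≡0-below = trans (maximum-principle s (ℤₚ.≤-reflexive (sym ΔΨ≡0))
      (λ y _ → subst (Ψ p y ≤_) (sym Ψs≡0) (Ψ≤0 p y)) (s ⊖ d) (down s)) Ψs≡0
    eq : ∀ a → 0ℤ - 1ℤ ≡ 0ℤ - (1ℤ + a) + (a - 0ℤ)
    eq = solve-∀

  -- Unlike in Θ, G need not be bounded above by Ψ p: Ψ p ⊓ G lies in Θ.
  ψ-least : ∀ k N {G} → Superharmonic G → (∀ z → Ψ p z - + k ≤ G z) →
            (∀ z → N ℕ.≤ ∣ p ∙ z ∣ → Ψ p z ≤ G z) → ∀ z → ψ z ≤ G z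
  ψ-least k N {G} G-super Ψ-k≤G Ψ≤G z =
    ℤₚ.≤-trans (minimal (ℕₚ.m≤m⊔n K k) θ z) (ℤₚ.i⊓j≤j (Ψ p z) (G z))
    where
    C : ℕ
    -- Where the minimum differs from `Ψ`, the level is below `N` in absolute value, so level 0,
    -- part of `D (Ψ p)`, is within `N * ∥ q ∥`; `suc` makes the radius positive.
    C = suc (N ℕ.* ∥ q ∥)
    lower : ∀ z → Ψ p z - + (K ℕ.⊔ k) ≤ Ψ p z ⊓ G z
    lower z = ℤₚ.⊓-glb (≤-by₁ (+≤+ {0} {K ℕ.⊔ k} ℕ.z≤n) (eq₁ (Ψ p z) (+ (K ℕ.⊔ k))))
      (≤-by₂ (Ψ-k≤G z) (+≤+ (ℕₚ.m≤n⊔m K k)) (eq₂ (Ψ p z) (G z) (+ k) (+ (K ℕ.⊔ k))))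
      where
      eq₁ : ∀ a b → a - (a - b) ≡ b - 0ℤ
      eq₁ = solve-∀
      eq₂ : ∀ a g k l → g - (a - l) ≡ g - (a - k) + (l - k)
      eq₂ = solve-∀
    near : ∀ z → Ψ p z ≢ Ψ p z ⊓ G z → B C (D (Ψ p)) z
    near z Ψ≢ with N ℕₚ.≤? ∣ p ∙ z ∣
    ... | yes N≤ = contradiction (sym (ℤₚ.i≤j⇒i⊓j≡i (Ψ≤G z N≤))) Ψ≢
    ... | no  N≰ = lift 0ℤ z , level-zero⊆D-Ψ _ (∙-lift 0ℤ z)
      , lift-dist 0ℤ z (ℕₚ.m≤n⇒m≤1+n (ℕₚ.*-monoˡ-≤ ∥ q ∥
          (subst (ℕ._≤ N) (sym distance) (ℕₚ.<⇒≤ (ℕₚ.≰⇒> N≰)))))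
      where
      distance : ∣ 0ℤ - p ∙ z ∣ ≡ ∣ p ∙ z ∣
      distance = trans (cong ∣_∣ (ℤₚ.+-identityˡ (- (p ∙ z)))) (ℤₚ.∣-i∣≡∣i∣ (p ∙ z))
    -- The index is raised because `ψ` is known to be minimal only from `K` on.
    θ : Θ (K ℕ.⊔ k) (Ψ p) (λ z → Ψ p z ⊓ G z)
    θ = record
      { superharmonic = ⊓-superharmonic (Ψ-superharmonic p) G-super
      ; lower         = lower
      ; upper         = λ z → ℤₚ.i⊓j≤i (Ψ p z) (G z)
      ; near          = C , ℕ.s≤s ℕ.z≤n , near
      }

  -- The translate of `ψ`, raised by `c`, is a competitor: translation keeps it superharmonic, and
  -- far away it is the translate of `Ψ`, where the hypothesis applies. With `v` equal to `q`, `- q`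
  -- or a vector of level 0, this gives monotonicity, the Lipschitz bound and constancy on levels.
  ψ-shift : ∀ v c → (∀ z → Ψ p z ≤ Ψ p (z ⊕ v) + c) → ∀ z → ψ z ≤ ψ (z ⊕ v) + c
  ψ-shift v c Ψ≤ = ψ-least K (M ℕ.+ ∣ p ∙ v ∣)
    (λ z → subst (_≤ 0ℤ) (sym (trans (Δ-+ _ (λ _ → c) z)
      (trans (cong₂ _+_ (sym (Δ-⊕ ψ z v)) (Δ-const c z)) (ℤₚ.+-identityʳ _)))) (ψ-superharmonic (z ⊕ v)))
    (λ z → ≤-by₂ (Ψ≤ z) (ψ-lower (z ⊕ v)) (eq (Ψ p z) (Ψ p (z ⊕ v)) c (ψ (z ⊕ v)) (+ K)))
    (λ z far → subst (λ a → Ψ p z ≤ a + c) (sym (ψ≡Ψ (z ⊕ v) (still-far z far))) (Ψ≤ z))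
    where
    eq : ∀ a b c e k → e + c - (a - k) ≡ b + c - a + (e - (b - k))
    eq = solve-∀
    still-far : ∀ z → M ℕ.+ ∣ p ∙ v ∣ ℕ.≤ ∣ p ∙ z ∣ → M ℕ.≤ ∣ p ∙ (z ⊕ v) ∣
    still-far z far = ℕₚ.+-cancelʳ-≤ ∣ p ∙ v ∣ _ _ (ℕₚ.≤-trans far
      (subst (λ a → ∣ a ∣ ℕ.≤ ∣ p ∙ (z ⊕ v) ∣ ℕ.+ ∣ p ∙ v ∣)
        (trans (cong (λ a → a - p ∙ v) (∙-⊕ p z v)) (cancel (p ∙ z) (p ∙ v)))
        (ℤₚ.∣i-j∣≤∣i∣+∣j∣ (p ∙ (z ⊕ v)) (p ∙ v))))
      where
      cancel : ∀ a b → a + b - b ≡ a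
      cancel = solve-∀

  ψ-monotone : ∀ z → ψ z ≤ ψ (z ⊕ q)
  ψ-monotone z = subst (ψ z ≤_) (ℤₚ.+-identityʳ _) (ψ-shift q 0ℤ
    (λ x → subst (Ψ p x ≤_) (sym (ℤₚ.+-identityʳ _)) (ℤₚ.⊓-monoʳ-≤ 0ℤ
      (subst (p ∙ x ≤_) (sym (∙-⊕ p x q))
        (subst (λ a → p ∙ x ≤ p ∙ x + a) (sym p∙q≡1) (ℤₚ.i≤i+j (p ∙ x) 1ℤ))))) z)

  Ψ-1-lipschitz : ∀ i → 0ℤ ⊓ i ≤ 0ℤ ⊓ (i - 1ℤ) + 1ℤ
  Ψ-1-lipschitz i with ℤₚ.⊓-sel 0ℤ (i - 1ℤ)
  ... | inj₁ eq = subst (λ a → 0ℤ ⊓ i ≤ a + 1ℤ) (sym eq)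
    (ℤₚ.≤-trans (ℤₚ.i⊓j≤i 0ℤ i) (+≤+ ℕ.z≤n))
  ... | inj₂ eq = subst (λ a → 0ℤ ⊓ i ≤ a + 1ℤ) (sym eq)
    (ℤₚ.≤-trans (ℤₚ.i⊓j≤j 0ℤ i) (ℤₚ.≤-reflexive (cancel i)))
    where
    cancel : ∀ i → i ≡ i - 1ℤ + 1ℤ
    cancel = solve-∀

  ψ-1-lipschitz : ∀ z → ψ (z ⊕ q) ≤ ψ z + 1ℤ
  ψ-1-lipschitz z = subst (λ x → ψ (z ⊕ q) ≤ ψ x + 1ℤ) (cancel z q)
    (ψ-shift (-1ℤ · q) 1ℤ
      (λ x → subst (λ a → Ψ p x ≤ 0ℤ ⊓ a + 1ℤ)
        (sym (trans (∙-⊕ p x _) (cong (λ a → p ∙ x + a)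
          (trans (∙-·ʳ -1ℤ p q) (cong (-1ℤ *_) p∙q≡1)))))
        (Ψ-1-lipschitz (p ∙ x))) (z ⊕ q))
    where
    cancel : ∀ {n} (z q : ℤ^ n) → (z ⊕ q) ⊕ (-1ℤ · q) ≡ z
    cancel []      []      = refl
    cancel (a ∷ z) (b ∷ q) = cong₂ _∷_ (eq a b) (cancel z q)
      where
      eq : ∀ a b → a + b + -1ℤ * b ≡ a
      eq = solve-∀

  LevelFunction : (ℤ^ n → ℤ) → Set
  LevelFunction F = ∀ x y → p ∙ x ≡ p ∙ y → F x ≡ F y

  ∙-shift-level : ∀ {x y} → p ∙ x ≡ p ∙ y → ∀ z → p ∙ z ≡ p ∙ (z ⊕ (y ⊖ x))
  ∙-shift-level {x} {y} eq z = sym (trans (∙-⊕ p z (y ⊖ x)) (trans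
    (cong (λ a → p ∙ z + a) (trans (∙-⊖ p y x) (ℤₚ.i≡j⇒i-j≡0 (sym eq))))
    (ℤₚ.+-identityʳ _)))

  ψ-level : LevelFunction ψ
  ψ-level x y eq = ℤₚ.≤-antisym (ψ-mono x y eq) (ψ-mono y x (sym eq))
    where
    ψ-mono : ∀ x y → p ∙ x ≡ p ∙ y → ψ x ≤ ψ y
    ψ-mono x y eq = subst (ψ x ≤_) (trans (ℤₚ.+-identityʳ _) (cong ψ (⊕-⊖-cancel x y)))
      (ψ-shift (y ⊖ x) 0ℤ (λ z → ℤₚ.≤-reflexive (trans
        (cong (0ℤ ⊓_) (∙-shift-level {x} {y} eq z)) (sym (ℤₚ.+-identityʳ _)))) x)

  Δ-level : ∀ {F} → LevelFunction F → LevelFunction (Δ F)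
  Δ-level {F} level x y eq = trans
    (Δ-cong (λ z → level z (z ⊕ (y ⊖ x)) (∙-shift-level {x} {y} eq z)) x)
    (trans (sym (Δ-⊕ F x (y ⊖ x))) (cong (Δ F) (⊕-⊖-cancel x y)))

  -- Otherwise ψ would vanish all the way down by the maximum principle.
  D-ψ-inhabited : ∃[ s ] D ψ s
  -- The walk starts at level `M` and loses at least one level per step, so this fuel ends it at
  -- level `- (M + 1)` or lower, where `ψ` is `p ∙ z` and negative.
  D-ψ-inhabited = walk (M ℕ.+ suc M) top (ψ≡0-above top (ℤₚ.≤-reflexive (sym top-level)))
    (ℤₚ.≤-reflexive (trans top-level (eq₀ (+ M) (+ suc M))))
    where
    top : ℤ^ n
    top = lift (+ M) q
    top-level : p ∙ top ≡ + M
    top-level = ∙-lift (+ M) q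
    eq₀ : ∀ a b → a ≡ a + b - b
    eq₀ = solve-∀
    walk : ∀ fuel z → ψ z ≡ 0ℤ → p ∙ z ≤ + fuel - + suc M → ∃[ s ] D ψ s
    walk zero z ψz≡0 z≤ = contradiction
      (≤-by₂ negative
             (ℤₚ.≤-reflexive (trans (sym ψz≡0) (ψ≡∙-below z below))) (eq₃ (p ∙ z))) 1≰0
      where
      eq₁ : ∀ m a → - a - m ≡ 0ℤ - (1ℤ + m) - a + (1ℤ - 0ℤ)
      eq₁ = solve-∀
      eq₂ : ∀ m a → 0ℤ - (1ℤ + a) ≡ 0ℤ - (1ℤ + m) - a + (m - 0ℤ)
      eq₂ = solve-∀
      eq₃ : ∀ a → 0ℤ - 1ℤ ≡ 0ℤ - (1ℤ + a) + (a - 0ℤ)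
      eq₃ = solve-∀
      negative : 1ℤ + p ∙ z ≤ 0ℤ
      negative = ≤-by₂ z≤ (+≤+ {0} {M} ℕ.z≤n) (eq₂ (+ M) (p ∙ z))
      below : + M ≤ - (p ∙ z)
      below = ≤-by₂ z≤ (+≤+ {0} {1} ℕ.z≤n) (eq₁ (+ M) (p ∙ z))
    walk (suc fuel) z ψz≡0 z≤ with Δ ψ z ℤₚ.≟ 0ℤ
    ... | no  Δψz≢0 = z , Δψz≢0
    ... | yes Δψz≡0 = walk fuel (z ⊖ d)
      (trans (maximum-principle z (ℤₚ.≤-reflexive (sym Δψz≡0))
        (λ y _ → subst (ψ y ≤_) (sym ψz≡0) (ψ≤0 y)) (z ⊖ d) (down z)) ψz≡0)
      (≤-by₂ z≤ (∙-descends z) (eq (+ fuel) (+ suc M) (p ∙ z) (p ∙ (z ⊖ d))))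
      where
      eq : ∀ f m a b → f - m - b ≡ 1ℤ + f - m - a + (a - (1ℤ + b))
      eq = solve-∀

  -- `D ψ` is a union of levels and not empty, so every `z` can reach it along `q` over a distance
  -- controlled by `p ∙ z`; a large distance therefore forces a large level. Were `D ψ` empty, every
  -- point would be far.
  far⇒∣∙∣≥ : ∀ N → ∃[ R ] (0 ℕ.< R × ∀ z → Far R (D ψ) z → N ℕ.≤ ∣ p ∙ z ∣)
  far⇒∣∙∣≥ N = R , ℕ.s≤s ℕ.z≤n , λ z far → ℕₚ.≮⇒≥ λ ∣p∙z∣<N →
    ℕₚ.<⇒≱ (far (lift (p ∙ s) z) (lift∈D z)) (lift-dist (p ∙ s) z
      (ℕₚ.m≤n⇒m≤1+n (ℕₚ.*-monoˡ-≤ ∥ q ∥ (ℕₚ.≤-trans (ℤₚ.∣i-j∣≤∣i∣+∣j∣ (p ∙ s) (p ∙ z))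
        (ℕₚ.+-monoʳ-≤ ∣ p ∙ s ∣ (ℕₚ.<⇒≤ ∣p∙z∣<N))))))
    where
    s : ℤ^ n
    s = proj₁ D-ψ-inhabited
    R : ℕ
    R = suc ((∣ p ∙ s ∣ ℕ.+ N) ℕ.* ∥ q ∥)
    lift∈D : ∀ z → D ψ (lift (p ∙ s) z)
    lift∈D z = proj₂ D-ψ-inhabited ∘ trans (Δ-level ψ-level _ _ (sym (∙-lift (p ∙ s) z)))

-- Connectedness of the lattice and finite ranges of levels

dist²-refl : ∀ {n} (x : ℤ^ n) → dist² x x ≡ 0
dist²-refl []      = refl
dist²-refl (a ∷ x) = cong₂ (λ i m → ∣ i ∣ ℕ.^ 2 ℕ.+ m) (ℤₚ.+-inverseʳ a) (dist²-refl x)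

dist²-sym : ∀ {n} (x y : ℤ^ n) → dist² x y ≡ dist² y x
dist²-sym []      []      = refl
dist²-sym (a ∷ x) (b ∷ y) = cong₂ (λ c e → c ℕ.^ 2 ℕ.+ e) (ℤₚ.∣i-j∣≡∣j-i∣ a b) (dist²-sym x y)

neighbour-sym : ∀ {n} {x y : ℤ^ n} → y ∈ neighbours x → x ∈ neighbours y
neighbour-sym {x = x} {y} y∈ = ~⇒∈-neighbours y x (trans (dist²-sym y x) (∈-neighbours⇒~ x y y∈))

ℤ-connected : (A : ℤ → Set) → (∀ a → A a → A (a + 1ℤ)) → (∀ a → A a → A (a - 1ℤ)) →
              ∀ a b → A a → A b
ℤ-connected A up down a b Aa = subst A (eq₀ a b) (go (b - a))
  where
  eq₀ : ∀ a b → a + (b - a) ≡ b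
  eq₀ = solve-∀
  eq₁ : ∀ a k → a + k + 1ℤ ≡ a + (1ℤ + k)
  eq₁ = solve-∀
  eq₂ : ∀ a k → a - k - 1ℤ ≡ a - (1ℤ + k)
  eq₂ = solve-∀
  climb : ∀ k → A (a + + k)
  climb zero    = subst A (sym (ℤₚ.+-identityʳ a)) Aa
  climb (suc k) = subst A (eq₁ a (+ k)) (up (a + + k) (climb k))
  sink : ∀ k → A (a - + k)
  sink zero    = subst A (sym (ℤₚ.+-identityʳ a)) Aa
  sink (suc k) = subst A (eq₂ a (+ k)) (down (a - + k) (sink k))
  go : ∀ c → A (a + c)
  go (+ k)    = climb k
  go -[1+ k ] = sink (suc k)

lattice-connected : ∀ {n} (A : ℤ^ n → Set) → (∀ x y → y ∈ neighbours x → A x → A y) →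
                    ∀ x y → A x → A y
lattice-connected A step []      []      Ax = Ax
lattice-connected A step (a ∷ x) (b ∷ y) Ax = ℤ-connected (λ c → A (c ∷ y))
  (λ c → step (c ∷ y) _ (here refl)) (λ c → step (c ∷ y) _ (there (here refl))) a b
  (lattice-connected (λ v → A (a ∷ v))
    (λ u v v∈ → step (a ∷ u) (a ∷ v) (there (there (∈-map⁺ (a ∷_) v∈)))) x y Ax)

∈⇒∣∣<sum : ∀ {m} {L : List ℤ} → m ∈ L → ∣ m ∣ ℕ.< sum (List.map (suc ∘ ∣_∣) L)
∈⇒∣∣<sum (here refl) = ℕₚ.m≤m+n _ _
∈⇒∣∣<sum (there m∈) = ℕₚ.≤-trans (∈⇒∣∣<sum m∈) (ℕₚ.m≤n+m _ _)

symmetric-interval : ℕ → List ℤ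
symmetric-interval b = List.map +_ (List.upTo (suc b)) List.++
                       List.map (λ i → - + i) (List.upTo (suc b))

∈-symmetric-interval : ∀ b m → ∣ m ∣ ℕ.≤ b → m ∈ symmetric-interval b
∈-symmetric-interval b (+ k)    k≤b = ∈-++⁺ˡ (∈-map⁺ +_ (∈-upTo⁺ (ℕ.s≤s k≤b)))
∈-symmetric-interval b -[1+ k ] k<b = ∈-++⁺ʳ (List.map +_ (List.upTo (suc b)))
  (∈-map⁺ (λ i → - + i) (∈-upTo⁺ (ℕ.s≤s k<b)))

full+1 : ∀ n → full n + 1ℤ ≡ + (2 ℕ.* n)
full+1 n = eq (+ (2 ℕ.* n))
  where
  eq : ∀ a → a - 1ℤ + 1ℤ ≡ a
  eq = solve-∀

binary : ∀ {i} → 0ℤ ≤ i → i ≤ 1ℤ → i ≡ 0ℤ ⊎ i ≡ 1ℤ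
binary {+ 0}           _  _                   = inj₁ refl
binary {+ 1}           _  _                   = inj₂ refl
binary {+ suc (suc _)} _  (+≤+ (ℕ.s≤s ()))
binary { -[1+ _ ]}     () _

-- Q contains, with any set of neighbours whose topplings make z unstable, z itself.
ClosedUnderToppling : ∀ {n} → State n → (ℤ^ n → Set) → Set
ClosedUnderToppling {n} φ Q = ∀ z (w : ℤ^ n → ℤ) →
  (∀ y → y ∈ neighbours z → w y ≡ 0ℤ ⊎ (w y ≡ 1ℤ × Q y)) →
  + (2 ℕ.* n) ≤ φ z + ∑ w (neighbours z) → Q z

-- Every vertex with odometer 1 is forced to topple

module Propagation {n} (p q : ℤ^ n) (p∙q≡1 : p ∙ q ≡ 1ℤ)
                   (ψ : ℤ^ n → ℤ) (canonical : IsCanonicalHusking p ψ) where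

  open Canonical p q p∙q≡1 ψ canonical

  -- The summand `∥ p ∥` keeps the neighbours, too, where `ψ` is linear.
  depth : ℕ
  depth = M ℕ.+ ∥ p ∥

  Δψ≡0-below : ∀ z → + depth ≤ - (p ∙ z) → Δ ψ z ≡ 0ℤ
  Δψ≡0-below z z-deep = trans (Δ-cong-local z
    (ψ≡∙-below z (ℤₚ.≤-trans (+≤+ (ℕₚ.m≤m+n M ∥ p ∥)) z-deep))
    λ y y∈ → ψ≡∙-below y (≤-by₂ z-deep (neighbour-upper p y∈)
      (eq (+ M) (+ ∥ p ∥) (p ∙ z) (p ∙ y))))
    (Δ-linear p z)
    where
    eq : ∀ m k z y → - y - m ≡ - z - (m + k) + (z + k - y)
    eq = solve-∀

  odometer : ℤ^ n → ℤ
  odometer z = ψ (z ⊕ q) - ψ z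

  odometer-binary : ∀ z → odometer z ≡ 0ℤ ⊎ odometer z ≡ 1ℤ
  odometer-binary z = binary (ℤₚ.i≤j⇒0≤j-i (ψ-monotone z))
    (≤-by₁ (ψ-1-lipschitz z) (eq (ψ (z ⊕ q)) (ψ z)))
    where
    eq : ∀ a b → 1ℤ - (a - b) ≡ b + 1ℤ - a
    eq = solve-∀

  ∙-⊕q : ∀ z → p ∙ (z ⊕ q) ≡ p ∙ z + 1ℤ
  ∙-⊕q z = trans (∙-⊕ p z q) (cong (λ a → p ∙ z + a) p∙q≡1)

  sink : ℕ → ℤ^ n → ℤ^ n
  sink zero    z = z
  sink (suc t) z = sink t z ⊖ d

  sink-neighbour : ∀ t {x y} → y ∈ neighbours x → sink t y ∈ neighbours (sink t x)
  sink-neighbour zero    y∈ = y∈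
  sink-neighbour (suc t) y∈ = subst₂ (λ u v → u ∈ neighbours v) (⊕-neg _ d) (⊕-neg _ d)
    (∈-neighbours-⊕ (-1ℤ · d) (sink-neighbour t y∈))

  sink-level : ∀ t z → p ∙ sink t z + + t ≤ p ∙ z
  sink-level zero    z = ℤₚ.≤-reflexive (ℤₚ.+-identityʳ (p ∙ z))
  sink-level (suc t) z = ≤-by₂ (sink-level t z) (∙-descends (sink t z))
    (eq (p ∙ z) (p ∙ sink t z) (p ∙ (sink t z ⊖ d)) (+ t))
    where
    eq : ∀ z s r t → z - (r + (1ℤ + t)) ≡ z - (s + t) + (s - (1ℤ + r))
    eq = solve-∀

  sink-deep : ∀ {t} z → depth ℕ.+ ∣ p ∙ z ∣ ℕ.≤ t → + depth ≤ - (p ∙ sink t z)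
  sink-deep {t} z T≤t = ≤-by₃ (+≤+ T≤t) (sink-level t z) (i≤+∣i∣ (p ∙ z))
    (eq (+ depth) (p ∙ z) (p ∙ sink t z) (+ t) (+ ∣ p ∙ z ∣))
    where
    eq : ∀ D z s t a → - s - D ≡ t - (D + a) + (z - (s + t)) + (a - z)
    eq = solve-∀

  -- L lists the values of p ∙ (z ⊕ q) at which the wave has not arrived yet:
  -- front L (z ⊕ q) is ψ z plus the number of topplings at z so far.
  front : List ℤ → ℤ^ n → ℤ
  front L x = if ⌊ (p ∙ x) ∈? L ⌋ then ψ (x ⊖ q) else ψ x

  module _ (L : List ℤ) where

    front-∈ : ∀ {x} → p ∙ x ∈ L → front L x ≡ ψ (x ⊖ q)
    front-∈ {x} x∈ with (p ∙ x) ∈? L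
    ... | yes _   = refl
    ... | no  x∉  = contradiction x∈ x∉

    front-⊕q-∈ : ∀ {z} → p ∙ (z ⊕ q) ∈ L → front L (z ⊕ q) ≡ ψ z
    front-⊕q-∈ {z} z∈ = trans (front-∈ z∈) (ψ-level _ z (trans (∙-⊖ p (z ⊕ q) q)
      (trans (cong (λ a → a - p ∙ q) (∙-⊕ p z q)) (eq (p ∙ z) (p ∙ q)))))
      where
      eq : ∀ a b → a + b - b ≡ a
      eq = solve-∀

    front-∉ : ∀ {x} → p ∙ x ∉ L → front L x ≡ ψ x
    front-∉ {x} x∉ with (p ∙ x) ∈? L
    ... | yes x∈ = contradiction x∈ x∉
    ... | no  _  = refl

    front≤ψ : ∀ x → front L x ≤ ψ x
    front≤ψ x with (p ∙ x) ∈? L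
    ... | yes _ = subst (λ y → ψ (x ⊖ q) ≤ ψ y) (⊖-⊕-cancel x q) (ψ-monotone (x ⊖ q))
    ... | no  _ = ℤₚ.≤-refl

    ψ≤front+1 : ∀ x → ψ x ≤ front L x + 1ℤ
    ψ≤front+1 x with (p ∙ x) ∈? L
    ... | yes _ = subst (λ y → ψ y ≤ ψ (x ⊖ q) + 1ℤ) (⊖-⊕-cancel x q) (ψ-1-lipschitz (x ⊖ q))
    ... | no  _ = ℤₚ.i≤i+j (ψ x) 1ℤ

    front-level : LevelFunction (front L)
    front-level x y eq = cong₂ (λ m ab → if ⌊ m ∈? L ⌋ then proj₁ ab else proj₂ ab) eq
      (cong₂ _,_ (ψ-level _ _ (trans (∙-⊖ p x q) (trans (cong (λ a → a - p ∙ q) eq) (sym (∙-⊖ p y q)))))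
                 (ψ-level x y eq))

    -- Off `L` the values at neighbours are only lowered, so superharmonicity is in question on `L`
    -- alone. As `L` is finite and values drop by at most 1, `front L` is a competitor with index
    -- `suc K`.
    ψ≤front : (∀ x → p ∙ x ∈ L → Δ (front L) x ≤ 0ℤ) → ∀ x → ψ x ≤ front L x
    ψ≤front super-on-L = ψ-least (suc K) (M ℕ.+ bound) super
      (λ x → ≤-by₂ (ψ-lower x) (ψ≤front+1 x) (eq (Ψ p x) (ψ x) (front L x) (+ K)))
      (λ x far → ℤₚ.≤-reflexive (trans (sym (ψ≡Ψ x (ℕₚ.m+n≤o⇒m≤o M far)))
        (sym (front-∉ λ x∈ → ℕₚ.<⇒≱ (∈⇒∣∣<sum x∈) (ℕₚ.m+n≤o⇒n≤o M far)))))
      where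
      bound : ℕ
      bound = sum (List.map (suc ∘ ∣_∣) L)
      eq : ∀ Ψ ψ f K → f - (Ψ - (1ℤ + K)) ≡ ψ - (Ψ - K) + (f + 1ℤ - ψ)
      eq = solve-∀
      super : Superharmonic (front L)
      super x = case (p ∙ x) ∈? L of λ where
        (yes x∈) → super-on-L x x∈
        (no  x∉) → ℤₚ.≤-trans (Δ-mono-≤ x (front-∉ x∉) λ y _ → front≤ψ y) (ψ-superharmonic x)

  module _ (φ : State n) (φ≡full+Δψ : ∀ z → φ z ≡ full n + Δ ψ z)
           (Q : ℤ^ n → Set) (closed : ClosedUnderToppling φ Q) where

    -- Where `ψ` is linear, `φ` is full, so a single toppled neighbour makes a vertex unstable; the
    -- weight is the indicator of that neighbour.
    spread : ∀ {y z} → y ∈ neighbours z → + depth ≤ - (p ∙ z) → Q y → Q z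
    spread {y} {z} y∈ z-deep Qy = closed z (λ x → indicator (x ≟ y)) supported
      (ℤₚ.≤-reflexive (sym (trans (cong₂ _+_ φz≡full
        (∑-indicator-∈ y (neighbours z) (neighbours-unique z) y∈)) (full+1 n))))
      where
      φz≡full : φ z ≡ full n
      φz≡full = trans (φ≡full+Δψ z)
        (trans (cong (λ a → full n + a) (Δψ≡0-below z z-deep)) (ℤₚ.+-identityʳ (full n)))
      supported : ∀ x → x ∈ neighbours z →
                  indicator (x ≟ y) ≡ 0ℤ ⊎ (indicator (x ≟ y) ≡ 1ℤ × Q x)
      supported x _ with x ≟ y
      ... | yes x≡y = inj₂ (refl , subst Q (sym x≡y) Qy)
      ... | no  _   = inj₁ refl

    -- Asking for large `t` only makes the property pass along every lattice step, including steps
    -- outside the half-space, where `spread` does not apply.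
    EventuallyBelow : ℤ^ n → Set
    EventuallyBelow z = ∃[ T ] (∀ t → T ℕ.≤ t → Q (sink t z))

    -- Paths inside the half-space are obtained by sinking arbitrary lattice paths.
    half-space : ∀ {z₀} → + depth ≤ - (p ∙ z₀) → Q z₀ → ∀ z → + depth ≤ - (p ∙ z) → Q z
    half-space {z₀} z₀-deep Qz₀ z z-deep =
      let T , Q-below = lattice-connected EventuallyBelow sideways z₀ z (0 , λ t _ → fall t)
      in rise T (Q-below T ℕₚ.≤-refl)
      where
      deeper : ∀ {z} t → + depth ≤ - (p ∙ z) → + depth ≤ - (p ∙ sink t z)
      deeper {z} t deep = ≤-by₃ deep (sink-level t z) (+≤+ {0} {t} ℕ.z≤n)
        (eq (+ depth) (p ∙ z) (p ∙ sink t z) (+ t))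
        where
        eq : ∀ D z s t → - s - D ≡ - z - D + (z - (s + t)) + (t - 0ℤ)
        eq = solve-∀
      fall : ∀ t → Q (sink t z₀)
      fall zero    = Qz₀
      fall (suc t) = spread (neighbour-sym (down (sink t z₀))) (deeper (suc t) z₀-deep) (fall t)
      rise : ∀ t → Q (sink t z) → Q z
      rise zero    Qz = Qz
      rise (suc t) Qz = rise t (spread (down (sink t z)) (deeper t z-deep) Qz)
      sideways : ∀ x y → y ∈ neighbours x → EventuallyBelow x → EventuallyBelow y
      sideways x y y∈ (T , Q-below) = T ℕ.⊔ (depth ℕ.+ ∣ p ∙ y ∣) , λ t T≤t →
        spread (sink-neighbour t (neighbour-sym y∈))
          (sink-deep y (ℕₚ.m⊔n≤o⇒n≤o T _ T≤t)) (Q-below t (ℕₚ.m⊔n≤o⇒m≤o T _ T≤t))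

    Cleared : List ℤ → Set
    Cleared L = ∀ z → odometer z ≡ 1ℤ → p ∙ (z ⊕ q) ∉ L → Q z

    -- Let every vertex cleared so far topple its share `w`. Then `ψ + w` is `front L` translated by
    -- `q`, and `w z = 0` because the level of `z` is still in `L`; so `z` carries
    -- `full n + Δ (front L) (z ⊕ q)` grains, at least `2n`. Constancy on levels extends this from
    -- one point to the whole level.
    clear-level : ∀ {L m} → Cleared L → m ∈ L → 0ℤ < Δ (front L) (lift m q) →
                  ∀ z → p ∙ (z ⊕ q) ≡ m → Q z
    clear-level {L} {m} cleared m∈ 0<Δ z z-level = closed z w supported
      (subst₂ _≤_ (full+1 n) (sym grains) (ℤₚ.+-monoʳ-≤ (full n)
        (subst (1ℤ ≤_) (Δ-level (front-level L) _ _ (trans (∙-lift m q) (sym z-level))) (ℤₚ.i<j⇒suc[i]≤j 0<Δ))))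
      where
      w : ℤ^ n → ℤ
      w y = front L (y ⊕ q) - ψ y
      w≡0 : ∀ y → p ∙ (y ⊕ q) ∈ L → w y ≡ 0ℤ
      w≡0 y y∈ = ℤₚ.i≡j⇒i-j≡0 (front-⊕q-∈ L y∈)
      supported : ∀ y → y ∈ neighbours z → w y ≡ 0ℤ ⊎ (w y ≡ 1ℤ × Q y)
      supported y _ = case (p ∙ (y ⊕ q)) ∈? L of λ where
        (yes y∈) → inj₁ (w≡0 y y∈)
        (no  y∉) → let w≡u = cong (λ a → a - ψ y) (front-∉ L y∉) in
          Sum.map (trans w≡u) (λ u≡1 → trans w≡u u≡1 , cleared y u≡1 y∉)
                            (odometer-binary y)
      ∑w≡Δw : ∑ w (neighbours z) ≡ Δ w z
      ∑w≡Δw = sym (trans (cong (λ a → - + (2 ℕ.* n) * a + ∑ w (neighbours z))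
                            (w≡0 z (subst (_∈ L) (sym z-level) m∈)))
                  (trans (cong (_+ ∑ w (neighbours z)) (ℤₚ.*-zeroʳ (- + (2 ℕ.* n))))
                         (ℤₚ.+-identityˡ _)))
      grains : φ z + ∑ w (neighbours z) ≡ full n + Δ (front L) (z ⊕ q)
      grains = begin
        φ z + ∑ w (neighbours z)                 ≡⟨ cong₂ _+_ (φ≡full+Δψ z) ∑w≡Δw ⟩
        full n + Δ ψ z + Δ w z                   ≡⟨ ℤₚ.+-assoc (full n) _ _ ⟩
        full n + (Δ ψ z + Δ w z)                 ≡⟨ cong (λ a → full n + a) (sym (Δ-+ ψ w z)) ⟩
        full n + Δ (λ y → ψ y + w y) z           ≡⟨ cong (λ a → full n + a)
                                                      (Δ-cong (λ y → eq (ψ y) (front L (y ⊕ q))) z) ⟩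
        full n + Δ (λ y → front L (y ⊕ q)) z     ≡⟨ cong (λ a → full n + a) (sym (Δ-⊕ (front L) z q)) ⟩
        full n + Δ (front L) (z ⊕ q)             ∎
        where
        open ≡-Reasoning
        eq : ∀ a b → a + (b - a) ≡ b
        eq = solve-∀

    -- By ψ≤front, as long as a level of L has not fired, some level of L is unstable.
    clear : ∀ k L → List.length L ℕ.≤ k → Cleared L → ∀ z → odometer z ≡ 1ℤ → Q z
    clear k L len cleared z u≡1 with any? (λ m → 0ℤ ℤₚ.<? Δ (front L) (lift m q)) L
    clear k L len cleared z u≡1 | no none with (p ∙ (z ⊕ q)) ∈? L
    ... | no  z∉ = cleared z u≡1 z∉
    ... | yes z∈ = contradiction (subst (_≤ 0ℤ) u≡1 u≤0) 1≰0
      where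
      stable : ∀ x → p ∙ x ∈ L → Δ (front L) x ≤ 0ℤ
      stable x x∈ = ℤₚ.≮⇒≥ λ 0<Δ → none (lose x∈
        (subst (0ℤ <_) (Δ-level (front-level L) _ _ (sym (∙-lift (p ∙ x) q))) 0<Δ))
      u≤0 : odometer z ≤ 0ℤ
      u≤0 = ℤₚ.i≤j⇒i-j≤0 (subst (ψ (z ⊕ q) ≤_) (front-⊕q-∈ L z∈)
        (ψ≤front L stable (z ⊕ q)))
    clear k L len cleared z u≡1 | yes found with find found
    clear zero    L len cleared z u≡1 | yes found | m , m∈ , _ =
      contradiction (ℕₚ.<-≤-trans (∈-length m∈) len) λ ()
    clear (suc k) L len cleared z u≡1 | yes found | m , m∈ , 0<Δ =
      -- Filtering removes every copy of `m`; the list may have repetitions, as `symmetric-interval`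
      -- contains 0 twice.
      clear k (List.filter ≢m? L)
        (ℕₚ.≤-pred (ℕₚ.<-≤-trans (Listₚ.filter-notAll ≢m? L (lose m∈ λ m≢m → m≢m refl)) len))
        cleared′ z u≡1
      where
      ≢m? : ∀ l → Dec (l ≢ m)
      ≢m? l = ¬? (l ℤₚ.≟ m)
      cleared′ : Cleared (List.filter ≢m? L)
      cleared′ y u≡1 y∉ with (p ∙ (y ⊕ q)) ℤₚ.≟ m
      ... | yes y-level = clear-level cleared m∈ 0<Δ y y-level
      ... | no  y≢m     = cleared y u≡1 λ y∈ → y∉ (∈-filter⁺ ≢m? y∈ y≢m)

    -- Only the levels from `- depth` to `depth` are left to `clear`: above them the odometer is 0,
    -- and below them lies the half-space. The level of `z` is one less than that of `z ⊕ q`, which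
    -- `suc depth` absorbs on the upper side.
    propagation : ∀ {z₀} → + depth ≤ - (p ∙ z₀) → Q z₀ → ∀ z → odometer z ≡ 1ℤ → Q z
    propagation {z₀} z₀-deep Qz₀ = clear _ (symmetric-interval depth) ℕₚ.≤-refl λ z u≡1 z∉ →
      outside z u≡1 (≤∣i∣-cases (p ∙ (z ⊕ q))
        (ℕₚ.≰⇒> λ ∣z∣≤ → z∉ (∈-symmetric-interval depth _ ∣z∣≤)))
      where
      outside : ∀ z → odometer z ≡ 1ℤ →
                + suc depth ≤ p ∙ (z ⊕ q) ⊎ + suc depth ≤ - (p ∙ (z ⊕ q)) → Q z
      outside z u≡1 (inj₁ above) = contradiction (trans (sym u≡1)
        (ℤₚ.i≡j⇒i-j≡0 (trans (ψ≡0-above (z ⊕ q) above₁) (sym (ψ≡0-above z above₀))))) λ ()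
        where
        eq : ∀ z m → z - m ≡ z + 1ℤ - (1ℤ + m)
        eq = solve-∀
        M≤1+depth : M ℕ.≤ suc depth
        M≤1+depth = ℕₚ.m≤n⇒m≤1+n (ℕₚ.m≤m+n M ∥ p ∥)
        above₁ : + M ≤ p ∙ (z ⊕ q)
        above₁ = ℤₚ.≤-trans (+≤+ M≤1+depth) above
        above₀ : + M ≤ p ∙ z
        above₀ = ℤₚ.≤-trans (+≤+ (ℕₚ.m≤m+n M ∥ p ∥))
          (≤-by₁ (subst (+ suc depth ≤_) (∙-⊕q z) above) (eq (p ∙ z) (+ depth)))
      outside z u≡1 (inj₂ below) = half-space z₀-deep Qz₀ z
        (≤-by₂ (subst (λ a → + suc depth ≤ - a) (∙-⊕q z) below) (+≤+ {0} {2} ℕ.z≤n)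
          (eq (p ∙ z) (+ depth)))
        where
        eq : ∀ z m → - z - m ≡ - (z + 1ℤ) - (1ℤ + m) + (+ 2 - 0ℤ)
        eq = solve-∀

-- Enumerations visiting every vertex at arbitrarily late times

Recurrent : {A : Set} → (ℕ → A) → Set
Recurrent e = ∀ a t → ∃[ t′ ] (t ℕ.≤ t′ × e t′ ≡ a)

next : ℕ × ℕ → ℕ × ℕ
next (zero  , y) = suc y , zero
next (suc x , y) = x , suc y

diagonal : ℕ → ℕ × ℕ
diagonal zero    = zero , zero
diagonal (suc t) = next (diagonal t)

diagonal-bound : ∀ t → proj₁ (diagonal t) ℕ.+ proj₂ (diagonal t) ℕ.≤ t
diagonal-bound zero    = ℕ.z≤n
diagonal-bound (suc t) with diagonal t | diagonal-bound t
... | zero  , y | y≤t   = ℕ.s≤s (subst (ℕ._≤ t) (sym (ℕₚ.+-identityʳ y)) y≤t)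
... | suc x , y | x+y<t = ℕₚ.m≤n⇒m≤1+n (subst (ℕ._≤ t) (sym (ℕₚ.+-suc x y)) x+y<t)

-- Inverts `next`: `s` numbers the antidiagonal, `y` the position on it, and the recursion is
-- lexicographic in the two.
diagonal-surjective : ∀ s x y → x ℕ.+ y ≡ s → ∃[ t ] diagonal t ≡ (x , y)
diagonal-surjective s       x       (suc y) x+y≡s =
  let t , eq = diagonal-surjective s (suc x) y (trans (sym (ℕₚ.+-suc x y)) x+y≡s)
  in suc t , cong next eq
diagonal-surjective zero    zero    zero    _     = 0 , refl
diagonal-surjective (suc s) (suc x) zero    x+0≡s =
  let t , eq = diagonal-surjective s zero x
                 (trans (sym (ℕₚ.+-identityʳ x)) (ℕₚ.suc-injective x+0≡s))
  in suc t , cong next eq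

diagonal-late : ∀ x y → ∃[ t ] (x ℕ.+ y ℕ.≤ t × diagonal t ≡ (x , y))
diagonal-late x y =
  let t , eq = diagonal-surjective _ x y refl
  in t , subst (λ xy → proj₁ xy ℕ.+ proj₂ xy ℕ.≤ t) eq (diagonal-bound t) , eq

ℤ-enumeration : ℕ → ℤ
ℤ-enumeration t = + proj₁ (diagonal t) - + proj₂ (diagonal t)

ℤ-enumeration-recurrent : Recurrent ℤ-enumeration
ℤ-enumeration-recurrent a t with difference a
  where
  difference : ∀ a → ∃[ x ] ∃[ y ] + x - + y ≡ a
  difference (+ x)    = x , 0 , ℤₚ.+-identityʳ (+ x)
  difference -[1+ y ] = 0 , suc y , refl
-- The integer is also `(t + x) - (t + y)`, and that pair occurs no earlier than the sum of its
-- entries, hence not before `t`.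
... | x , y , x-y≡a with diagonal-late (t ℕ.+ x) (t ℕ.+ y)
... | t′ , ≤t′ , eq = t′ , ℕₚ.m+n≤o⇒m≤o t (ℕₚ.m+n≤o⇒m≤o (t ℕ.+ x) ≤t′)
  , trans (cong (λ xy → + proj₁ xy - + proj₂ xy) eq) (trans (cancel (+ t) (+ x) (+ y)) x-y≡a)
  where
  cancel : ∀ t x y → t + x - (t + y) ≡ x - y
  cancel = solve-∀

enumeration : ∀ n → ℕ → ℤ^ n
enumeration zero    t = []
enumeration (suc n) t =
  ℤ-enumeration (proj₁ (diagonal t)) ∷ enumeration n (proj₂ (diagonal t))

enumeration-recurrent : ∀ n → Recurrent (enumeration n)
enumeration-recurrent zero    []      t = t , ℕₚ.≤-refl , refl
enumeration-recurrent (suc n) (a ∷ z) t =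
  -- Lateness of the tail is enough: the index of a pair is at least each of its entries.
  let i , _   , i≡a = ℤ-enumeration-recurrent a 0
      j , t≤j , j≡z = enumeration-recurrent n z t
      t′ , ≤t′ , eq = diagonal-late i j
  in t′ , ℕₚ.≤-trans t≤j (ℕₚ.m+n≤o⇒n≤o i ≤t′)
     , trans (cong (λ ij → ℤ-enumeration (proj₁ ij) ∷ enumeration n (proj₂ ij)) eq)
             (cong₂ _∷_ i≡a j≡z)

-- Toppling as a Laplacian, and existence of a relaxation

topple≡+Δ : ∀ {n} (z : ℤ^ n) σ x → topple z σ x ≡ σ x + Δ (λ y → indicator (y ≟ z)) x
topple≡+Δ {n} z σ x with x ≟ z
... | yes refl = cong (λ a → σ x + a) (sym (trans
  (cong (λ a → - + (2 ℕ.* n) * 1ℤ + a) (∑-indicator-∉ x (neighbours x) λ x∈ →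
    contradiction (trans (sym (dist²-refl x)) (∈-neighbours⇒~ x x x∈)) λ ()))
  (eq (+ (2 ℕ.* n)))))
  where
  eq : ∀ m → - m * 1ℤ + 0ℤ ≡ - m
  eq = solve-∀
... | no _ with dist² x z ℕₚ.≟ 1
... | yes x~z = cong (λ a → σ x + a) (sym (trans
  (cong (λ a → - + (2 ℕ.* n) * 0ℤ + a)
    (∑-indicator-∈ z (neighbours x) (neighbours-unique x) (~⇒∈-neighbours x z x~z)))
  (cong (_+ 1ℤ) (ℤₚ.*-zeroʳ (- + (2 ℕ.* n))))))
... | no  x≁z = sym (trans (cong (λ a → σ x + a) (trans
  (cong (λ a → - + (2 ℕ.* n) * 0ℤ + a)
    (∑-indicator-∉ z (neighbours x) (x≁z ∘ ∈-neighbours⇒~ x z)))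
  (cong (_+ 0ℤ) (ℤₚ.*-zeroʳ (- + (2 ℕ.* n)))))) (ℤₚ.+-identityʳ (σ x)))

topple-elsewhere : ∀ {n} {z y : ℤ^ n} σ → z ≢ y → σ z ≤ topple y σ z
topple-elsewhere {z = z} {y} σ z≢y with z ≟ y
... | yes z≡y = contradiction z≡y z≢y
... | no _ with dist² z y ℕₚ.≟ 1
... | yes _ = ℤₚ.i≤i+j (σ z) 1ℤ
... | no  _ = ℤₚ.≤-refl

unstable? : ∀ {n} (σ : State n) z → Dec (Unstable σ z)
unstable? {n} σ z = + (2 ℕ.* n) ℤₚ.≤? σ z

-- Each vertex visited by the enumeration is toppled if it is unstable. Topplings elsewhere never
-- remove grains from a vertex, so an unstable one stays so until it topples, at its next visit at
-- the latest.
relaxation : ∀ {n} (σ : State n) → Relaxation σ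
relaxation {n} σ = record
  { schedule   = schedule
  ; legal      = λ t z eq → subst (λ τ → Unstable τ z) (sym (run≡state t)) (legal t z eq)
  ; exhaustive = λ t z unstable →
      exhaustive t z (subst (λ τ → Unstable τ z) (run≡state t) unstable)
  }
  where
  attempt : State n → ℤ^ n → Maybe (ℤ^ n)
  attempt τ z = if ⌊ unstable? τ z ⌋ then just z else nothing
  -- The schedule has to inspect the state, so the states are computed first and identified with
  -- `run` afterwards.
  state : ℕ → State n
  state zero    = σ
  state (suc t) = step (attempt (state t) (enumeration n t)) (state t)
  schedule : Schedule n
  schedule t = attempt (state t) (enumeration n t)
  run≡state : ∀ t → run schedule σ t ≡ state t
  run≡state zero    = refl
  run≡state (suc t) = cong (step (schedule t)) (run≡state t)
  legal : ∀ t z → schedule t ≡ just z → Unstable (state t) z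
  legal t z eq with unstable? (state t) (enumeration n t) | eq
  ... | yes unstable | refl = unstable
  ... | no  _        | ()
  attempt-unstable : ∀ τ {z} → Unstable τ z → attempt τ z ≡ just z
  attempt-unstable τ {z} unstable with unstable? τ z
  ... | yes _ = refl
  ... | no  stable = contradiction unstable stable
  persists : ∀ t z → schedule t ≢ just z → Unstable (state t) z → Unstable (state (suc t)) z
  persists t z idle unstable with schedule t
  ... | nothing = unstable
  ... | just y  = ℤₚ.≤-trans unstable
    (topple-elsewhere (state t) λ z≡y → idle (cong just (sym z≡y)))
  search : ∀ k t z → Unstable (state t) z → enumeration n (k ℕ.+ t) ≡ z →
           ∃[ t′ ] (t ℕ.≤ t′ × schedule t′ ≡ just z)
  search zero    t z unstable eq = t , ℕₚ.≤-refl
    , subst (λ y → attempt (state t) y ≡ just z) (sym eq) (attempt-unstable (state t) unstable)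
  search (suc k) t z unstable eq with Maybeₚ.≡-dec _≟_ (schedule t) (just z)
  ... | yes now  = t , ℕₚ.≤-refl , now
  ... | no  idle =
    let t′ , t<t′ , eq′ = search k (suc t) z (persists t z idle unstable)
                            (trans (cong (enumeration n) (ℕₚ.+-suc k t)) eq)
    in t′ , ℕₚ.<⇒≤ t<t′ , eq′
  exhaustive : ∀ t z → Unstable (state t) z → ∃[ t′ ] (t ℕ.≤ t′ × schedule t′ ≡ just z)
  exhaustive t z unstable =
    let t′ , t≤t′ , eq = enumeration-recurrent n z t
    in search (t′ ℕ.∸ t) t z unstable (trans (cong (enumeration n) (ℕₚ.m∸n+n≡m t≤t′)) eq)

-- The odometer of a wave

eventually-all : ∀ {A : Set} {P : ℕ → A → Set} xs →
  (∀ x → x ∈ xs → ∃[ T ] (∀ t → T ℕ.≤ t → P t x)) →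
  ∃[ T ] (∀ t → T ℕ.≤ t → ∀ x → x ∈ xs → P t x)
eventually-all []       _    = 0 , λ _ _ _ ()
eventually-all (x ∷ xs) each =
  let T₁ , P₁ = each x (here refl)
      T₂ , P₂ = eventually-all xs (λ y y∈ → each y (there y∈))
  in T₁ ℕ.⊔ T₂ , λ where
       t T≤t _ (here refl) → P₁ t (ℕₚ.m⊔n≤o⇒m≤o T₁ T₂ T≤t)
       t T≤t y (there y∈)  → P₂ t (ℕₚ.m⊔n≤o⇒n≤o T₁ T₂ T≤t) y y∈

indicator-nonneg : {P : Set} (p? : Dec P) → 0ℤ ≤ indicator p?
indicator-nonneg (yes _) = +≤+ ℕ.z≤n
indicator-nonneg (no  _) = ℤₚ.≤-refl

indicator-≡ : ∀ {n} (z : ℤ^ n) → indicator (z ≟ z) ≡ 1ℤ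
indicator-≡ z with z ≟ z
... | yes _  = refl
... | no z≢z = contradiction refl z≢z

-- The relaxation `r` is arbitrary, which gives independence of the order: `u-forced` does not
-- mention `r` and is applied to the vertices that topple eventually in `r`.
module Wave {n} {φ χ u : ℤ^ n → ℤ} {z₀ : ℤ^ n}
            (χ≡φ+Δu : ∀ z → χ z ≡ φ z + Δ u z)
            (χ-stable : ∀ z → χ z ≤ full n)
            (u-binary : ∀ z → u z ≡ 0ℤ ⊎ u z ≡ 1ℤ)
            (u-origin : u z₀ ≡ 1ℤ)
            (u-forced : ∀ (Q : ℤ^ n → Set) → ClosedUnderToppling φ Q → Q z₀ →
                        ∀ z → u z ≡ 1ℤ → Q z)
            (r : Relaxation (topple z₀ φ)) where

  open Relaxation r

  record-toppling : Maybe (ℤ^ n) → (ℤ^ n → ℤ) → ℤ^ n → ℤ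
  record-toppling nothing  v x = v x
  record-toppling (just z) v x = v x + indicator (x ≟ z)

  topplings : ℕ → ℤ^ n → ℤ
  -- The toppling that starts the wave is counted although it is not in the schedule; this puts `z₀`
  -- among the toppled vertices.
  topplings zero    x = indicator (x ≟ z₀)
  topplings (suc t) = record-toppling (schedule t) (topplings t)

  state : ℕ → State n
  state = run schedule (topple z₀ φ)

  state≡φ+Δ : ∀ t x → state t x ≡ φ x + Δ (topplings t) x
  state≡φ+Δ zero    x = topple≡+Δ z₀ φ x
  state≡φ+Δ (suc t) x with schedule t
  ... | nothing = state≡φ+Δ t x
  ... | just z  = trans (topple≡+Δ z (state t) x) (trans
    (cong (_+ Δ (λ y → indicator (y ≟ z)) x) (state≡φ+Δ t x))
    (trans (ℤₚ.+-assoc (φ x) _ _) (cong (λ a → φ x + a) (sym (Δ-+ (topplings t) _ x)))))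

  topplings-step : ∀ t x → topplings t x ≤ topplings (suc t) x
  topplings-step t x with schedule t
  ... | nothing = ℤₚ.≤-refl
  ... | just z  = subst (_≤ topplings t x + indicator (x ≟ z)) (ℤₚ.+-identityʳ _)
    (ℤₚ.+-monoʳ-≤ (topplings t x) (indicator-nonneg (x ≟ z)))

  topplings-mono : ∀ {t t′} → t ℕ.≤ t′ → ∀ x → topplings t x ≤ topplings t′ x
  topplings-mono t≤t′ x = go (ℕₚ.≤⇒≤′ t≤t′)
    where
    go : ∀ {t t′} → t ℕ.≤′ t′ → topplings t x ≤ topplings t′ x
    go ℕ.≤′-refl        = ℤₚ.≤-refl
    go (ℕ.≤′-step t≤t′) = ℤₚ.≤-trans (go t≤t′) (topplings-step _ x)

  topplings-nonneg : ∀ t x → 0ℤ ≤ topplings t x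
  topplings-nonneg t x = ℤₚ.≤-trans (indicator-nonneg (x ≟ z₀)) (topplings-mono {0} {t} ℕ.z≤n x)

  0≤u : ∀ x → 0ℤ ≤ u x
  0≤u x with u-binary x
  ... | inj₁ u≡0 = ℤₚ.≤-reflexive (sym u≡0)
  ... | inj₂ u≡1 = subst (0ℤ ≤_) (sym u≡1) (+≤+ ℕ.z≤n)

  -- Least action principle: where the bound u is attained the state is at most χ,
  -- so no toppling is legal there.
  topplings≤u : ∀ t x → topplings t x ≤ u x
  topplings≤u zero    x with x ≟ z₀
  ... | yes refl = ℤₚ.≤-reflexive (sym u-origin)
  ... | no  _    = 0≤u x
  topplings≤u (suc t) x with schedule t in scheduled
  ... | nothing = topplings≤u t x
  ... | just z with x ≟ z
  ... | no  _    = subst (_≤ u x) (sym (ℤₚ.+-identityʳ _)) (topplings≤u t x)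
  ... | yes refl with topplings t x ℤₚ.<? u x
  ... | yes v<u = subst (_≤ u x) (ℤₚ.+-comm 1ℤ (topplings t x)) (ℤₚ.i<j⇒suc[i]≤j v<u)
  ... | no  v≮u = contradiction
    (≤-by₃ (legal t x scheduled) (ℤₚ.≤-reflexive (state≡φ+Δ t x))
      (ℤₚ.≤-trans (ℤₚ.+-monoʳ-≤ (φ x) (Δ-mono-≤ x
          (ℤₚ.≤-antisym (topplings≤u t x) (ℤₚ.≮⇒≥ v≮u)) λ y _ → topplings≤u t y))
        (subst (_≤ full n) (χ≡φ+Δu x) (χ-stable x)))
      (eq (+ (2 ℕ.* n)) (state t x) (φ x + Δ (topplings t) x))) 1≰0
    where
    eq : ∀ m s v → 0ℤ - 1ℤ ≡ s - m + (v - s) + (m - 1ℤ - v)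
    eq = solve-∀

  Topples : ℤ^ n → Set
  Topples z = ∃[ T ] (∀ t → T ℕ.≤ t → 1ℤ ≤ topplings t z)

  topples-once : ∀ {t z} → 1ℤ ≤ topplings t z → Topples z
  topples-once {t} {z} 1≤ = t , λ t′ t≤t′ → ℤₚ.≤-trans 1≤ (topplings-mono t≤t′ z)

  -- After a common time all neighbours counted by `w` have toppled. If `z` has not, it has lost no
  -- grains and is unstable, so `exhaustive` makes it topple later.
  Topples-closed : ClosedUnderToppling φ Topples
  Topples-closed z w supported heavy = topple-at-last
    where
    w-bounded : ∃[ T ] (∀ t → T ℕ.≤ t → ∀ y → y ∈ neighbours z → w y ≤ topplings t y)
    w-bounded = eventually-all (neighbours z) λ y y∈ → case supported y y∈ of λ where
      (inj₁ w≡0)              → 0 , λ t _ → subst (_≤ topplings t y) (sym w≡0) (topplings-nonneg t y)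
      (inj₂ (w≡1 , T , 1≤)) → T , λ t T≤t → subst (_≤ topplings t y) (sym w≡1) (1≤ t T≤t)
    T : ℕ
    T = proj₁ w-bounded
    topple-at-last : Topples z
    topple-at-last with 1ℤ ℤₚ.≤? topplings T z
    ... | yes 1≤ = topples-once {T} 1≤
    ... | no  1≰ = topples-once {suc t} toppled
      where
      v≡0 : topplings T z ≡ 0ℤ
      v≡0 = ℤₚ.≤-antisym (≤-by₁ (≰⇒1+≤ 1≰) (eq (topplings T z))) (topplings-nonneg T z)
        where
        eq : ∀ v → 0ℤ - v ≡ 1ℤ - (1ℤ + v)
        eq = solve-∀
      unstable : Unstable (state T) z
      unstable = ℤₚ.≤-trans heavy (subst (φ z + ∑ w (neighbours z) ≤_)
        (sym (trans (state≡φ+Δ T z) (cong (λ a → φ z + a) (trans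
          (cong (λ a → - + (2 ℕ.* n) * a + ∑ (topplings T) (neighbours z)) v≡0)
          (trans (cong (_+ ∑ (topplings T) (neighbours z)) (ℤₚ.*-zeroʳ (- + (2 ℕ.* n))))
                 (ℤₚ.+-identityˡ _))))))
        (ℤₚ.+-monoʳ-≤ (φ z) (∑-mono-≤ (neighbours z) (proj₂ w-bounded T ℕₚ.≤-refl))))
      t : ℕ
      t = proj₁ (exhaustive T z unstable)
      toppled : 1ℤ ≤ topplings (suc t) z
      toppled = subst (λ s → 1ℤ ≤ record-toppling s (topplings t) z)
        (sym (proj₂ (proj₂ (exhaustive T z unstable))))
        (subst (λ a → 1ℤ ≤ topplings t z + a) (sym (indicator-≡ z))
          (≤-by₁ (topplings-nonneg t z) (eq (topplings t z))))
        where
        eq : ∀ v → v + 1ℤ - 1ℤ ≡ v - 0ℤ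
        eq = solve-∀

  topplings-limit : ∀ z → ∃[ T ] (∀ t → T ℕ.≤ t → topplings t z ≡ u z)
  topplings-limit z with u-binary z
  ... | inj₁ u≡0 = 0 , λ t _ → ℤₚ.≤-antisym (topplings≤u t z)
    (subst (_≤ topplings t z) (sym u≡0) (topplings-nonneg t z))
  ... | inj₂ u≡1 =
    let T , 1≤ = u-forced Topples Topples-closed
                   (topples-once {0} (ℤₚ.≤-reflexive (sym (indicator-≡ z₀)))) z u≡1
    in T , λ t T≤t → ℤₚ.≤-antisym (topplings≤u t z) (subst (_≤ topplings t z) (sym u≡1) (1≤ t T≤t))

  endsAt : r EndsAt χ
  endsAt z =
    let T , limit = eventually-all (z ∷ neighbours z) (λ y _ → topplings-limit y)
    in T , λ t T≤t → trans (state≡φ+Δ t z) (trans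
      (cong (λ a → φ z + a) (Δ-cong-local z (limit t T≤t z (here refl))
        λ y y∈ → limit t T≤t y (there y∈)))
      (sym (χ≡φ+Δu z)))

-- Waves from either side

harmonic-around : ∀ {n R} {ψ : ℤ^ n → ℤ} {z₀} → 0 ℕ.< R → Far R (D ψ) z₀ →
                  ∀ y → dist² z₀ y ℕ.≤ 1 → Δ ψ y ≡ 0ℤ
harmonic-around {ψ = ψ} 0<R far y y-near = decidable-stable (Δ ψ y ℤₚ.≟ 0ℤ) λ y∈D →
  ℕₚ.<⇒≱ (far y y∈D) (ℕₚ.≤-trans y-near (ℕₚ.^-monoˡ-≤ 2 0<R))

module _ {n} (p q : ℤ^ n) (p∙q≡1 : p ∙ q ≡ 1ℤ)
         (ψ : ℤ^ n → ℤ) (canonical : IsCanonicalHusking p ψ) where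

  open Canonical p q p∙q≡1 ψ canonical
  open Propagation p q p∙q≡1 ψ canonical

  wave-from-below : ∀ {φ χ : State n} → (∀ z → φ z ≡ full n + Δ ψ z) →
    (∀ z → χ z ≡ full n + Δ ψ (z ⊕ q)) →
    ∀ {z₀} → + suc depth ≤ - (p ∙ z₀) → IsRelaxed (topple z₀ φ) χ
  wave-from-below {φ} {χ} φ≡ χ≡ {z₀} z₀-deep = relaxation (topple z₀ φ) ,
    Wave.endsAt χ≡φ+Δu χ-stable odometer-binary odometer-origin
      λ Q closed → propagation φ φ≡ Q closed (ℤₚ.≤-trans (ℤₚ.i≤j+i (+ depth) 1ℤ) z₀-deep)
    where
    χ≡φ+Δu : ∀ z → χ z ≡ φ z + Δ odometer z
    χ≡φ+Δu z = begin
      χ z                                        ≡⟨ χ≡ z ⟩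
      full n + Δ ψ (z ⊕ q)                       ≡⟨ cong (λ a → full n + a) (Δ-⊕ ψ z q) ⟩
      full n + Δ (λ x → ψ (x ⊕ q)) z             ≡⟨ cong (λ a → full n + a) (Δ-cong (λ x → eq (ψ x) (ψ (x ⊕ q))) z) ⟩
      full n + Δ (λ x → ψ x + odometer x) z      ≡⟨ cong (λ a → full n + a) (Δ-+ ψ odometer z) ⟩
      full n + (Δ ψ z + Δ odometer z)            ≡⟨ sym (ℤₚ.+-assoc (full n) _ _) ⟩
      full n + Δ ψ z + Δ odometer z              ≡⟨ cong (_+ Δ odometer z) (sym (φ≡ z)) ⟩
      φ z + Δ odometer z                         ∎
      where
      open ≡-Reasoning
      eq : ∀ a b → b ≡ a + (b - a)
      eq = solve-∀
    χ-stable : ∀ z → χ z ≤ full n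
    χ-stable z = subst₂ _≤_ (sym (χ≡ z)) (ℤₚ.+-identityʳ (full n))
      (ℤₚ.+-monoʳ-≤ (full n) (ψ-superharmonic (z ⊕ q)))
    odometer-origin : odometer z₀ ≡ 1ℤ
    odometer-origin = trans (cong₂ _-_
      (trans (ψ≡∙-below (z₀ ⊕ q) (subst (λ a → + M ≤ - a) (sym (∙-⊕q z₀))
        -- The unit in `suc depth` pays for the level gained by adding `q`, so that both `z₀` and
        -- `z₀ ⊕ q` lie where `ψ` is linear.
        (≤-by₂ z₀-deep (+≤+ {0} ℕ.z≤n) (eq₁ (p ∙ z₀) (+ M) (+ ∥ p ∥))))) (∙-⊕q z₀))
      (ψ≡∙-below z₀ (ℤₚ.≤-trans (+≤+ (ℕₚ.m≤n⇒m≤1+n (ℕₚ.m≤m+n M ∥ p ∥))) z₀-deep)))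
      (eq₂ (p ∙ z₀))
      where
      eq₁ : ∀ z m k → - (z + 1ℤ) - m ≡ - z - (1ℤ + (m + k)) + (k - 0ℤ)
      eq₁ = solve-∀
      eq₂ : ∀ a → a + 1ℤ - a ≡ 1ℤ
      eq₂ = solve-∀

proposition3p5 : (n : ℕ) → 1 ℕ.≤ n →
    (p : ℤ^ n) → Primitive p →
    (ψ : ℤ^ n → ℤ) → IsCanonicalHusking p ψ →
    (q : ℤ^ n) → p ∙ q ≡ 1ℤ →
    let φ = λ (z : ℤ^ n) → full n + Δ ψ z in
    ∃[ R ] (0 ℕ.< R × ((z₀ : ℤ^ n) → Far R (D ψ) z₀ →
    (ψ z₀ < 0ℤ → IsWave z₀ φ (λ z → φ (z ⊕ q))) ×
    (ψ z₀ ≡ 0ℤ → IsWave z₀ φ (λ z → φ (z ⊖ q)))))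
proposition3p5 n _ p _ ψ canonical q p∙q≡1 = R , 0<R , λ z₀ far →
    (λ ψz₀<0 → wave far (wave-from-below p q p∙q≡1 ψ canonical
      (λ _ → refl) (λ _ → refl) (negative-side z₀ (separated z₀ far) ψz₀<0)))
  , (λ ψz₀≡0 → wave far (wave-from-below p⁻ q⁻ p⁻∙q⁻≡1 ψ⁻ canonical⁻
      (λ z → cong (λ a → full n + a) (sym (Δψ⁻≡Δψ z)))
      (λ z → cong (λ a → full n + a)
        (trans (cong (Δ ψ) (sym (⊕-neg z q))) (sym (Δψ⁻≡Δψ (z ⊕ q⁻)))))
      (zero-side z₀ (separated z₀ far) ψz₀≡0)))
  where
  -- The case ψ z₀ = 0 is the case ψ z₀ < 0 for - p: adding the linear function - p ∙ z
  -- to ψ gives the husking of Ψ (- p) without changing the Laplacian.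
  p⁻ q⁻ : ℤ^ n
  p⁻ = -1ℤ · p
  q⁻ = -1ℤ · q
  ψ⁻ : ℤ^ n → ℤ
  ψ⁻ z = ψ z + p⁻ ∙ z
  p⁻∙q⁻≡1 : p⁻ ∙ q⁻ ≡ 1ℤ
  p⁻∙q⁻≡1 = neg-∙-neg p q p∙q≡1
  canonical⁻ : IsCanonicalHusking p⁻ ψ⁻
  canonical⁻ = canonical-neg p canonical
  Δψ⁻≡Δψ : ∀ z → Δ ψ⁻ z ≡ Δ ψ z
  Δψ⁻≡Δψ z = trans (Δ-+ ψ (p⁻ ∙_) z)
    (trans (cong (λ a → Δ ψ z + a) (Δ-linear p⁻ z)) (ℤₚ.+-identityʳ (Δ ψ z)))
  open Canonical p q p∙q≡1 ψ canonical
  module P  = Propagation p q p∙q≡1 ψ canonical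
  module P⁻ = Propagation p⁻ q⁻ p⁻∙q⁻≡1 ψ⁻ canonical⁻
  N : ℕ
  -- A sum, to exceed the depths required for `p` and for `- p`.
  N = suc P.depth ℕ.+ suc P⁻.depth
  R : ℕ
  R = proj₁ (far⇒∣∙∣≥ N)
  0<R : 0 ℕ.< R
  0<R = proj₁ (proj₂ (far⇒∣∙∣≥ N))
  separated : ∀ z₀ → Far R (D ψ) z₀ → + N ≤ p ∙ z₀ ⊎ + N ≤ - (p ∙ z₀)
  separated z₀ far = ≤∣i∣-cases (p ∙ z₀) (proj₂ (proj₂ (far⇒∣∙∣≥ N)) z₀ far)
  1+depth≤N : suc P.depth ℕ.≤ N
  1+depth≤N = ℕₚ.m≤m+n (suc P.depth) (suc P⁻.depth)
  M≤N : M ℕ.≤ N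
  M≤N = ℕₚ.≤-trans (ℕₚ.m≤n⇒m≤1+n (ℕₚ.m≤m+n M ∥ p ∥)) 1+depth≤N
  -- Far from `D ψ` the point lies well above or well below level 0, where `ψ` is 0 or `p ∙ z₀ < 0`
  -- respectively; the sign of `ψ z₀` thus tells the side.
  negative-side : ∀ z₀ → + N ≤ p ∙ z₀ ⊎ + N ≤ - (p ∙ z₀) → ψ z₀ < 0ℤ → + suc P.depth ≤ - (p ∙ z₀)
  negative-side z₀ (inj₁ above) ψz₀<0 =
    contradiction (ψ≡0-above z₀ (ℤₚ.≤-trans (+≤+ M≤N) above)) (ℤₚ.<⇒≢ ψz₀<0)
  negative-side z₀ (inj₂ below) _ = ℤₚ.≤-trans (+≤+ 1+depth≤N) below
  zero-side : ∀ z₀ → + N ≤ p ∙ z₀ ⊎ + N ≤ - (p ∙ z₀) → ψ z₀ ≡ 0ℤ → + suc P⁻.depth ≤ - (p⁻ ∙ z₀)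
  zero-side z₀ (inj₁ above) _ = subst (+ suc P⁻.depth ≤_)
    (sym (trans (cong -_ (neg-∙ p z₀)) (ℤₚ.neg-involutive (p ∙ z₀))))
    (ℤₚ.≤-trans (+≤+ (ℕₚ.m≤n+m (suc P⁻.depth) (suc P.depth))) above)
  zero-side z₀ (inj₂ below) ψz₀≡0 = contradiction
    (ℤₚ.≤-trans (+≤+ (ℕ.s≤s ℕ.z≤n)) (subst (λ a → + N ≤ - a)
      (trans (sym (ψ≡∙-below z₀ (ℤₚ.≤-trans (+≤+ M≤N) below))) ψz₀≡0) below)) 1≰0
  wave : ∀ {z₀ χ} → Far R (D ψ) z₀ → IsRelaxed (topple z₀ (λ z → full n + Δ ψ z)) χ →
         IsWave z₀ (λ z → full n + Δ ψ z) χ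
  wave {z₀} far relaxed = record
    { full-at = full-at z₀ (ℕₚ.≤-trans (ℕₚ.≤-reflexive (dist²-refl z₀)) ℕ.z≤n)
    ; full-by = z₀ ⊕ d , trans (dist²-sym (z₀ ⊕ d) z₀) z₀~ , full-at (z₀ ⊕ d) (ℕₚ.≤-reflexive z₀~)
    ; relaxed = relaxed
    }
    where
    z₀~ : z₀ ~ z₀ ⊕ d
    z₀~ = ∈-neighbours⇒~ z₀ (z₀ ⊕ d) (up z₀)
    full-at : ∀ y → dist² z₀ y ℕ.≤ 1 → full n + Δ ψ y ≡ full n
    full-at y y-near = trans (cong (λ a → full n + a) (harmonic-around {z₀ = z₀} 0<R far y y-near))
      (ℤₚ.+-identityʳ (full n))
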